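{- Let $\mathbb{F}_q$ be a finite field of characteristic different from $2$ with $q \equiv 1 \pmod 3$. Then there is a one-to-one correspondence, given by taking the quadratic twist, between $\mathbb{F}_q$-isomorphism classes of elliptic curves over $\mathbb{F}_q$ having an $\mathbb{F}_q$-rational point of order $3$ and $\mathbb{F}_q$-isomorphism classes of elliptic curves over $\mathbb{F}_q$ having a rational subgroup of order $3$ whose nonzero points are not defined over $\mathbb{F}_q$.
   Context: A subgroup $G\subset E(\overline{\mathbb{F}}_q)$ is called rational (over $\mathbb{F}_q$) if it is stable, as a set, under the $q$-power Frobenius map $(x,y)\mapsto(x^q,y^q)$; its individual points need not be defined over $\mathbb{F}_q$. The quadratic twist (twisted curve) of $y^2=x^3+Ax+B$ over $\mathbb{F}_q$ is $y^2=x^3+t^2Ax+t^3B$, where $t\in\mathbb{F}_q^*$ is a fixed non-square. -}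

module Defs where

open import Algebra.Bundles using (CommutativeRing; RawMonoid; Semiring)
import Algebra.Definitions.RawMonoid as RawMonoidDefinitions
import Algebra.Definitions.RawSemiring as RawSemiringDefinitions
open import Algebra.Morphism.Structures using (module RingMorphisms)
import Algebra.Solver.Ring.NaturalCoefficients.Default as NaturalSolver
open import Data.Fin.Base using (Fin)
open import Data.Nat.Base as ℕ using (ℕ; zero; suc)
open import Data.Product.Base using (Σ; Σ-syntax; ∃-syntax; _×_; _,_; proj₁; proj₂)
open import Data.Unit.Polymorphic.Base using (⊤)
open import Data.Vec.Base using (Vec; []; _∷_; map)
open import Function.Bundles using (Inverse)
open import Level using (Level; _⊔_) renaming (suc to lsuc)
open import Relation.Binary.Bundles using (Setoid)
import Relation.Binary.Construct.On as On
open import Relation.Binary.Definitions using (Decidable)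
import Relation.Binary.PropositionalEquality as ≡
import Relation.Binary.Reasoning.Setoid as SetoidReasoning
open import Relation.Nullary using (¬_; yes; no)
open import Relation.Unary using (Pred)

HasCardinality : ∀ {a ℓ} → Setoid a ℓ → ℕ → Set (a ⊔ ℓ)
HasCardinality S n = Inverse S (≡.setoid (Fin n))

-- Discrete fields.  The inverse is total, but its value at 0# is unspecified.
record Field (c ℓ : Level) : Set (lsuc (c ⊔ ℓ)) where
  infix 9 _⁻¹
  field
    commutativeRing : CommutativeRing c ℓ

  open CommutativeRing commutativeRing public
  open RawSemiringDefinitions (Semiring.rawSemiring semiring) public
    using (_^_) renaming (_×_ to _·_)

  field
    _≟_      : Decidable _≈_
    _⁻¹      : Carrier → Carrier
    1≉0      : ¬ (1# ≈ 0#)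
    inverseʳ : ∀ {x} → ¬ (x ≈ 0#) → x * x ⁻¹ ≈ 1#

  IsSquare : Carrier → Set (c ⊔ ℓ)
  IsSquare x = ∃[ s ] s * s ≈ x

  -- [ a₀ , … , aₙ₋₁ ] at x is a₀ + a₁ x + … + aₙ₋₁ xⁿ⁻¹.
  eval : ∀ {n} → Vec Carrier n → Carrier → Carrier
  eval []       x = 0#
  eval (a ∷ as) x = a + x * eval as x

  monicEval : ∀ {n} → Vec Carrier n → Carrier → Carrier
  monicEval {n} as x = x ^ n + eval as x

record AlgebraicClosure {c ℓ} (F : Field c ℓ) (c′ ℓ′ : Level)
       : Set (c ⊔ ℓ ⊔ lsuc (c′ ⊔ ℓ′)) where
  private module F = Field F
  field
    closure : Field c′ ℓ′
  private module K = Field closure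
  open RingMorphisms F.rawRing K.rawRing using (IsRingHomomorphism)
  field
    ι                  : F.Carrier → K.Carrier
    isRingHomomorphism : IsRingHomomorphism ι
    algebraic          : ∀ x → ∃[ n ] Σ[ as ∈ Vec F.Carrier n ]
                           K.monicEval (map ι as) x K.≈ K.0#
    closed             : ∀ {n} (as : Vec K.Carrier (suc n)) →
                           ∃[ x ] K.monicEval as x K.≈ K.0#

module _ {c ℓ} (K : Field c ℓ) where
  open Field K

  -- y² = x³ + Ax + B, not necessarily nonsingular.
  record Equation : Set c where
    constructor equation
    field
      A B : Carrier

  -- 𝒪 and all points of the affine plane; see GroupLaw.OnCurve.
  data Point : Set c where
    𝒪   : Point
    aff : (x y : Carrier) → Point

module Points {c ℓ} (K : Field c ℓ) where
  open Field K

  infix 4 _≈ₚ_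

  data _≈ₚ_ : Point K → Point K → Set (c ⊔ ℓ) where
    𝒪≈   : 𝒪 ≈ₚ 𝒪
    aff≈ : ∀ {x y x′ y′} → x ≈ x′ → y ≈ y′ → aff x y ≈ₚ aff x′ y′

  pointSetoid : Setoid c (c ⊔ ℓ)
  pointSetoid = record
    { Carrier       = Point K
    ; _≈_           = _≈ₚ_
    ; isEquivalence = record
      { refl  = λ { {𝒪} → 𝒪≈ ; {aff _ _} → aff≈ refl refl }
      ; sym   = λ { 𝒪≈ → 𝒪≈ ; (aff≈ p q) → aff≈ (sym p) (sym q) }
      ; trans = λ { 𝒪≈ 𝒪≈ → 𝒪≈
                  ; (aff≈ p q) (aff≈ p′ q′) → aff≈ (trans p p′) (trans q q′) }
      }
    }

  frobenius : ℕ → Point K → Point K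
  frobenius q 𝒪         = 𝒪
  frobenius q (aff x y) = aff (x ^ q) (y ^ q)

-- The chord-tangent formulas are given on all of Point K; they are the
-- group law of the curve only on points satisfying OnCurve.
module GroupLaw {c ℓ} (K : Field c ℓ) (E : Equation K) where
  open Field K
  open Equation E
  open Points K public

  OnCurve : Pred (Point K) ℓ
  OnCurve 𝒪         = ⊤
  OnCurve (aff x y) = y ^ 2 ≈ x ^ 3 + A * x + B

  neg : Point K → Point K
  neg 𝒪         = 𝒪
  neg (aff x y) = aff x (- y)

  -- Third intersection of the line of slope m through (x₁ , y₁), reflected.
  lineSum : (m x₁ y₁ x₂ : Carrier) → Point K
  lineSum m x₁ y₁ x₂ = aff x₃ (m * (x₁ - x₃) - y₁)
    where x₃ = m ^ 2 - x₁ - x₂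

  infixl 6 _⊕_
  _⊕_ : Point K → Point K → Point K
  𝒪         ⊕ Q         = Q
  aff x₁ y₁ ⊕ 𝒪         = aff x₁ y₁
  aff x₁ y₁ ⊕ aff x₂ y₂ with x₁ ≟ x₂ | y₁ ≟ (- y₂)
  ... | no  _ | _     = lineSum ((y₂ - y₁) * (x₂ - x₁) ⁻¹) x₁ y₁ x₂
  ... | yes _ | yes _ = 𝒪
  ... | yes _ | no  _ = lineSum ((3 · x₁ ^ 2 + A) * (2 · y₁) ⁻¹) x₁ y₁ x₂

  ⊕-rawMonoid : RawMonoid c (c ⊔ ℓ)
  ⊕-rawMonoid = record { Carrier = Point K ; _≈_ = _≈ₚ_ ; _∙_ = _⊕_ ; ε = 𝒪 }

  open RawMonoidDefinitions ⊕-rawMonoid public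
    using () renaming (_×_ to _·ₚ_)

  HasOrder : Point K → ℕ → Set (c ⊔ ℓ)
  HasOrder P n =
    (n ·ₚ P ≈ₚ 𝒪) × (∀ m → 0 ℕ.< m → m ℕ.< n → ¬ (m ·ₚ P ≈ₚ 𝒪))

  record IsSubgroup {p} (G : Pred (Point K) p) : Set (c ⊔ ℓ ⊔ p) where
    field
      respects   : ∀ {P Q} → P ≈ₚ Q → G P → G Q
      onCurve    : ∀ {P} → G P → OnCurve P
      𝒪∈         : G 𝒪
      ⊕-closed   : ∀ {P Q} → G P → G Q → G (P ⊕ Q)
      neg-closed : ∀ {P} → G P → G (neg P)

  subsetSetoid : ∀ {p} → Pred (Point K) p → Setoid (c ⊔ p) (c ⊔ ℓ)
  subsetSetoid G = On.setoid {B = Σ (Point K) G} pointSetoid proj₁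

module _ {c ℓ} (F : Field c ℓ) where
  open Field F

  -- Short Weierstrass form, which is general when the characteristic of F
  -- is neither 2 nor 3.
  record EllipticCurve : Set (c ⊔ ℓ) where
    field
      eqn : Equation F
    open Equation eqn public
    field
      nonsingular : ¬ (4 · A ^ 3 + 27 · B ^ 2 ≈ 0#)

  -- Isomorphisms over F: the admissible changes of variables
  --   x = u² x′ + r ,  y = u³ y′ + s u² x′ + t
  -- taking y² = x³ + Ax + B to u⁶ times y′² = x′³ + A′x′ + B′.  The
  -- equations compare the coefficients of x′y′, x′², y′, x′, 1 in turn
  -- (up to powers of u), with the negative terms moved across.
  record _≅_ (E E′ : EllipticCurve) : Set (c ⊔ ℓ) where
    private
      module E  = EllipticCurve E
      module E′ = EllipticCurve E′
    field
      u r s t : Carrier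
      u≉0     : ¬ (u ≈ 0#)
      xy-coeff : 2 · s ≈ 0#
      x²-coeff : 3 · r ≈ s ^ 2
      y-coeff  : 2 · t ≈ 0#
      x-coeff  : u ^ 4 * E′.A + 2 · (s * t) ≈ E.A + 3 · r ^ 2
      1-coeff  : u ^ 6 * E′.B + t ^ 2 ≈ E.B + r * E.A + r ^ 3

module Curves {c ℓ} (F : Field c ℓ) where
  open Field F
  open NaturalSolver commutativeSemiring
  open SetoidReasoning setoid

  private
    +≈ˡ : ∀ {x y} z → x ≈ y → x + z ≈ y + z
    +≈ˡ z p = +-cong p refl

    +≈ʳ : ∀ {x y} z → x ≈ y → z + x ≈ z + y
    +≈ʳ z p = +-cong refl p

    *≈ʳ : ∀ {x y} z → x ≈ y → z * x ≈ z * y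
    *≈ʳ z p = *-cong refl p

    *-zero : ∀ {x} z → x ≈ 0# → z * x ≈ 0#
    *-zero z p = trans (*≈ʳ z p) (zeroʳ z)

    drop : ∀ {x y} → y ≈ 0# → x + y ≈ x
    drop {x} p = trans (+≈ʳ x p) (+-identityʳ x)

    *-nonzero : ∀ {x y} → ¬ (x ≈ 0#) → ¬ (y ≈ 0#) → ¬ (x * y ≈ 0#)
    *-nonzero {x} {y} x≉0 y≉0 xy≈0 = y≉0 (begin
      y                ≈⟨ sym (*-identityˡ y) ⟩
      1# * y           ≈⟨ *-cong (sym (inverseʳ x≉0)) refl ⟩
      x * x ⁻¹ * y     ≈⟨ solve 3 (λ a b d → a :* b :* d := b :* (a :* d)) refl x (x ⁻¹) y ⟩
      x ⁻¹ * (x * y)   ≈⟨ *-zero (x ⁻¹) xy≈0 ⟩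
      0#               ∎)

    ⁻¹-nonzero : ∀ {x} → ¬ (x ≈ 0#) → ¬ (x ⁻¹ ≈ 0#)
    ⁻¹-nonzero {x} x≉0 p = 1≉0 (trans (sym (inverseʳ x≉0)) (*-zero x p))

    cancel^ : ∀ {u w} n z → u * w ≈ 1# → (u * w) ^ n * z ≈ z
    cancel^ {u} {w} n z p = trans (*-cong (go n) refl) (*-identityˡ z)
      where
      go : ∀ n → (u * w) ^ n ≈ 1#
      go zero    = refl
      go (suc n) = trans (*-cong p (go n)) (*-identityˡ 1#)

    module Facts {E E′ : EllipticCurve F} (i : _≅_ F E E′) where
      private
        module E  = EllipticCurve E
        module E′ = EllipticCurve E′
      open _≅_ i

      2st≈0 : 2 · (s * t) ≈ 0#
      2st≈0 = trans (solve 2 (λ s t → 2 :× (s :* t) := t :* (2 :× s)) refl s t)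
                    (*-zero t xy-coeff)

      6r≈0 : 2 · (3 · r) ≈ 0#
      6r≈0 = begin
        2 · (3 · r)        ≈⟨ +-cong x²-coeff (+≈ˡ 0# x²-coeff) ⟩
        2 · (s ^ 2)        ≈⟨ solve 1 (λ s → 2 :× (s :^ 2) := s :* (2 :× s)) refl s ⟩
        s * (2 · s)        ≈⟨ *-zero s xy-coeff ⟩
        0#                 ∎

      x-coeff′ : u ^ 4 * E′.A ≈ E.A + 3 · r ^ 2
      x-coeff′ = trans (sym (drop 2st≈0)) x-coeff

      1-coeff′ : u ^ 6 * E′.B ≈ E.B + r * E.A + r ^ 3 + t ^ 2
      1-coeff′ = begin
        u ^ 6 * E′.B                       ≈⟨ sym (drop (*-zero t y-coeff)) ⟩
        u ^ 6 * E′.B + t * (2 · t)         ≈⟨ solve 2 (λ x t → x :+ t :* (2 :× t) := x :+ t :^ 2 :+ t :^ 2) refl (u ^ 6 * E′.B) t ⟩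
        u ^ 6 * E′.B + t ^ 2 + t ^ 2       ≈⟨ +≈ˡ (t ^ 2) 1-coeff ⟩
        E.B + r * E.A + r ^ 3 + t ^ 2      ∎

  ≅-refl : ∀ {E} → _≅_ F E E
  ≅-refl {E} = record
    { u = 1# ; r = 0# ; s = 0# ; t = 0#
    ; u≉0      = 1≉0
    ; xy-coeff = solve 0 (2 :× con 0 := con 0) refl
    ; x²-coeff = solve 0 (3 :× con 0 := con 0 :^ 2) refl
    ; y-coeff  = solve 0 (2 :× con 0 := con 0) refl
    ; x-coeff  = solve 1 (λ a → con 1 :^ 4 :* a :+ 2 :× (con 0 :* con 0)
                             := a :+ 3 :× (con 0 :^ 2)) refl A
    ; 1-coeff  = solve 2 (λ a b → con 1 :^ 6 :* b :+ con 0 :^ 2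
                               := b :+ con 0 :* a :+ con 0 :^ 3) refl A B
    }
    where open EllipticCurve E

  ≅-trans : ∀ {E E′ E″} → _≅_ F E E′ → _≅_ F E′ E″ → _≅_ F E E″
  ≅-trans {E} {E′} {E″} i j = record
    { u = u * v ; r = R ; s = S ; t = T
    ; u≉0      = *-nonzero i.u≉0 j.u≉0
    ; xy-coeff = 2S≈0
    ; x²-coeff = begin
        3 · R                                  ≈⟨ solve 3 (λ u r r′ → 3 :× (r :+ u :^ 2 :* r′) := 3 :× r :+ u :^ 2 :* (3 :× r′)) refl u r r′ ⟩
        3 · r + u ^ 2 * (3 · r′)               ≈⟨ +-cong i.x²-coeff (*≈ʳ (u ^ 2) j.x²-coeff) ⟩
        s ^ 2 + u ^ 2 * s′ ^ 2                 ≈⟨ sym (drop (*-zero (u * s′) i.xy-coeff)) ⟩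
        s ^ 2 + u ^ 2 * s′ ^ 2 + u * s′ * (2 · s)
          ≈⟨ solve 3 (λ u s s′ → s :^ 2 :+ u :^ 2 :* s′ :^ 2 :+ u :* s′ :* (2 :× s) := (s :+ u :* s′) :^ 2) refl u s s′ ⟩
        S ^ 2                                  ∎
    ; y-coeff  = begin
        2 · T
          ≈⟨ solve 5 (λ u s t r′ t′ → 2 :× (t :+ u :^ 3 :* t′ :+ u :^ 2 :* s :* r′)
                := 2 :× t :+ u :^ 3 :* (2 :× t′) :+ u :^ 2 :* r′ :* (2 :× s)) refl u s t r′ t′ ⟩
        2 · t + u ^ 3 * (2 · t′) + u ^ 2 * r′ * (2 · s)
          ≈⟨ drop (*-zero (u ^ 2 * r′) i.xy-coeff) ⟩
        2 · t + u ^ 3 * (2 · t′)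
          ≈⟨ drop (*-zero (u ^ 3) j.y-coeff) ⟩
        2 · t
          ≈⟨ i.y-coeff ⟩
        0# ∎
    ; x-coeff  = begin
        (u * v) ^ 4 * E″.A + 2 · (S * T)
          ≈⟨ drop (trans (solve 2 (λ S T → 2 :× (S :* T) := T :* (2 :× S)) refl S T) (*-zero T 2S≈0)) ⟩
        (u * v) ^ 4 * E″.A
          ≈⟨ solve 3 (λ u v a → (u :* v) :^ 4 :* a := u :^ 4 :* (v :^ 4 :* a)) refl u v E″.A ⟩
        u ^ 4 * (v ^ 4 * E″.A)
          ≈⟨ *≈ʳ (u ^ 4) fj.x-coeff′ ⟩
        u ^ 4 * (E′.A + 3 · r′ ^ 2)
          ≈⟨ distribˡ _ _ _ ⟩
        u ^ 4 * E′.A + u ^ 4 * (3 · r′ ^ 2)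
          ≈⟨ +≈ˡ _ fi.x-coeff′ ⟩
        E.A + 3 · r ^ 2 + u ^ 4 * (3 · r′ ^ 2)
          ≈⟨ sym (drop (*-zero (u ^ 2 * r′) fi.6r≈0)) ⟩
        E.A + 3 · r ^ 2 + u ^ 4 * (3 · r′ ^ 2) + u ^ 2 * r′ * (2 · (3 · r))
          ≈⟨ solve 4 (λ u r r′ a → a :+ 3 :× (r :^ 2) :+ u :^ 4 :* (3 :× (r′ :^ 2)) :+ u :^ 2 :* r′ :* (2 :× (3 :× r))
                := a :+ 3 :× ((r :+ u :^ 2 :* r′) :^ 2)) refl u r r′ E.A ⟩
        E.A + 3 · R ^ 2 ∎
    ; 1-coeff  = begin
        (u * v) ^ 6 * E″.B + T ^ 2
          ≈⟨ solve 7 (λ u v s t r′ t′ b →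
                (u :* v) :^ 6 :* b :+ (t :+ u :^ 3 :* t′ :+ u :^ 2 :* s :* r′) :^ 2
                := u :^ 6 :* (v :^ 6 :* b :+ t′ :^ 2) :+ t :^ 2 :+ u :^ 4 :* r′ :^ 2 :* s :^ 2
                   :+ (u :^ 3 :* t′ :+ u :^ 2 :* s :* r′) :* (2 :× t)
                   :+ u :^ 5 :* t′ :* r′ :* (2 :× s)) refl u v s t r′ t′ E″.B ⟩
        u ^ 6 * (v ^ 6 * E″.B + t′ ^ 2) + t ^ 2 + u ^ 4 * r′ ^ 2 * s ^ 2
          + (u ^ 3 * t′ + u ^ 2 * s * r′) * (2 · t) + u ^ 5 * t′ * r′ * (2 · s)
          ≈⟨ trans (drop (*-zero _ i.xy-coeff)) (drop (*-zero _ i.y-coeff)) ⟩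
        u ^ 6 * (v ^ 6 * E″.B + t′ ^ 2) + t ^ 2 + u ^ 4 * r′ ^ 2 * s ^ 2
          ≈⟨ +-cong (+≈ˡ _ (*≈ʳ _ j.1-coeff)) (*≈ʳ _ (sym i.x²-coeff)) ⟩
        u ^ 6 * (E′.B + r′ * E′.A + r′ ^ 3) + t ^ 2 + u ^ 4 * r′ ^ 2 * (3 · r)
          ≈⟨ solve 6 (λ u r t r′ a b →
                u :^ 6 :* (b :+ r′ :* a :+ r′ :^ 3) :+ t :^ 2 :+ u :^ 4 :* r′ :^ 2 :* (3 :× r)
                := (u :^ 6 :* b :+ t :^ 2) :+ u :^ 2 :* r′ :* (u :^ 4 :* a)
                   :+ (u :^ 6 :* r′ :^ 3 :+ u :^ 4 :* r′ :^ 2 :* (3 :× r))) refl u r t r′ E′.A E′.B ⟩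
        (u ^ 6 * E′.B + t ^ 2) + u ^ 2 * r′ * (u ^ 4 * E′.A)
          + (u ^ 6 * r′ ^ 3 + u ^ 4 * r′ ^ 2 * (3 · r))
          ≈⟨ +≈ˡ _ (+-cong i.1-coeff (*≈ʳ _ fi.x-coeff′)) ⟩
        (E.B + r * E.A + r ^ 3) + u ^ 2 * r′ * (E.A + 3 · r ^ 2)
          + (u ^ 6 * r′ ^ 3 + u ^ 4 * r′ ^ 2 * (3 · r))
          ≈⟨ solve 5 (λ u r r′ a b →
                (b :+ r :* a :+ r :^ 3) :+ u :^ 2 :* r′ :* (a :+ 3 :× (r :^ 2))
                  :+ (u :^ 6 :* r′ :^ 3 :+ u :^ 4 :* r′ :^ 2 :* (3 :× r))
                := b :+ (r :+ u :^ 2 :* r′) :* a :+ (r :+ u :^ 2 :* r′) :^ 3) refl u r r′ E.A E.B ⟩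
        E.B + R * E.A + R ^ 3 ∎
    }
    where
    module E  = EllipticCurve E
    module E′ = EllipticCurve E′
    module E″ = EllipticCurve E″
    module i  = _≅_ i
    module j  = _≅_ j
    module fi = Facts i
    module fj = Facts j
    open i using (u; r; s; t)
    open j using () renaming (u to v; r to r′; s to s′; t to t′)
    R S T : Carrier
    R = r + u ^ 2 * r′
    S = s + u * s′
    T = t + u ^ 3 * t′ + u ^ 2 * s * r′
    2S≈0 : 2 · S ≈ 0#
    2S≈0 = begin
      2 · S                  ≈⟨ solve 3 (λ u s s′ → 2 :× (s :+ u :* s′) := 2 :× s :+ u :* (2 :× s′)) refl u s s′ ⟩
      2 · s + u * (2 · s′)   ≈⟨ drop (*-zero u j.xy-coeff) ⟩
      2 · s                  ≈⟨ i.xy-coeff ⟩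
      0#                     ∎

  -- 3 r = s² and 2 s = 0 give - r = 2 r + s², so the inverse change of
  -- variables can be written without subtraction.
  ≅-sym : ∀ {E E′} → _≅_ F E E′ → _≅_ F E′ E
  ≅-sym {E} {E′} i = record
    { u = w ; r = R ; s = S ; t = T
    ; u≉0      = ⁻¹-nonzero u≉0
    ; xy-coeff = 2S≈0
    ; x²-coeff = begin
        3 · R
          ≈⟨ solve 3 (λ w r s → 3 :× (w :^ 2 :* (2 :× r :+ s :^ 2))
                := (w :* s) :^ 2 :+ w :^ 2 :* (2 :× (3 :× r)) :+ w :^ 2 :* s :* (2 :× s)) refl w r s ⟩
        S ^ 2 + w ^ 2 * (2 · (3 · r)) + w ^ 2 * s * (2 · s)
          ≈⟨ trans (drop (*-zero _ xy-coeff)) (drop (*-zero _ 6r≈0)) ⟩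
        S ^ 2 ∎
    ; y-coeff  = begin
        2 · T
          ≈⟨ solve 4 (λ w r s t → 2 :× (w :^ 3 :* (r :* s :+ t))
                := w :^ 3 :* (2 :× t) :+ w :^ 3 :* r :* (2 :× s)) refl w r s t ⟩
        w ^ 3 * (2 · t) + w ^ 3 * r * (2 · s)
          ≈⟨ drop (*-zero _ xy-coeff) ⟩
        w ^ 3 * (2 · t)
          ≈⟨ *-zero _ y-coeff ⟩
        0# ∎
    ; x-coeff  = begin
        w ^ 4 * E.A + 2 · (S * T)
          ≈⟨ drop (trans (solve 2 (λ S T → 2 :× (S :* T) := T :* (2 :× S)) refl S T) (*-zero T 2S≈0)) ⟩
        w ^ 4 * E.A
          ≈⟨ sym (drop (*-zero (w ^ 4) X≈0)) ⟩
        w ^ 4 * E.A + w ^ 4 * (r * s ^ 2 + 3 · r * s ^ 2)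
          ≈⟨ +≈ʳ _ (*≈ʳ _ (+-cong (*≈ʳ r (sym x²-coeff)) (*-cong x²-coeff refl))) ⟩
        w ^ 4 * E.A + w ^ 4 * (r * (3 · r) + s ^ 2 * s ^ 2)
          ≈⟨ sym (trans (drop (*-zero _ 6r≈0)) (drop (*-zero _ xy-coeff))) ⟩
        w ^ 4 * E.A + w ^ 4 * (r * (3 · r) + s ^ 2 * s ^ 2) + w ^ 4 * s ^ 3 * (2 · s)
          + w ^ 4 * (2 · r + 2 · s ^ 2) * (2 · (3 · r))
          ≈⟨ solve 4 (λ w r s a →
               w :^ 4 :* a :+ w :^ 4 :* (r :* (3 :× r) :+ s :^ 2 :* s :^ 2) :+ w :^ 4 :* s :^ 3 :* (2 :× s)
                 :+ w :^ 4 :* (2 :× r :+ 2 :× (s :^ 2)) :* (2 :× (3 :× r))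
               := w :^ 4 :* (a :+ 3 :× (r :^ 2)) :+ 3 :× ((w :^ 2 :* (2 :× r :+ s :^ 2)) :^ 2)) refl w r s E.A ⟩
        w ^ 4 * (E.A + 3 · r ^ 2) + 3 · R ^ 2
          ≈⟨ +≈ˡ _ (sym A′≈) ⟩
        E′.A + 3 · R ^ 2 ∎
    ; 1-coeff  = begin
        w ^ 6 * E.B + T ^ 2
          ≈⟨ solve 5 (λ w r s t b →
               w :^ 6 :* b :+ (w :^ 3 :* (r :* s :+ t)) :^ 2
               := w :^ 6 :* (b :+ t :^ 2 :+ r :^ 2 :* s :^ 2) :+ w :^ 6 :* r :* s :* (2 :× t)) refl w r s t E.B ⟩
        w ^ 6 * (E.B + t ^ 2 + r ^ 2 * s ^ 2) + w ^ 6 * r * s * (2 · t)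
          ≈⟨ drop (*-zero _ y-coeff) ⟩
        w ^ 6 * (E.B + t ^ 2 + r ^ 2 * s ^ 2)
          ≈⟨ sym (drop (*-zero (w ^ 6 * s ^ 2) X≈0)) ⟩
        w ^ 6 * (E.B + t ^ 2 + r ^ 2 * s ^ 2) + w ^ 6 * s ^ 2 * (r * s ^ 2 + 3 · r * s ^ 2)
          ≈⟨ +-cong (*≈ʳ _ (+≈ʳ _ (*≈ʳ _ (sym x²-coeff))))
                    (*≈ʳ _ (+-cong (*≈ʳ r (sym x²-coeff)) (*-cong x²-coeff refl))) ⟩
        w ^ 6 * (E.B + t ^ 2 + r ^ 2 * (3 · r)) + w ^ 6 * s ^ 2 * (r * (3 · r) + s ^ 2 * s ^ 2)
          ≈⟨ sym (trans (drop (*-zero _ 6r≈0)) (drop (*-zero _ 3r+s²≈0))) ⟩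
        w ^ 6 * (E.B + t ^ 2 + r ^ 2 * (3 · r)) + w ^ 6 * s ^ 2 * (r * (3 · r) + s ^ 2 * s ^ 2)
          + w ^ 6 * E.A * (3 · r + s ^ 2)
          + w ^ 6 * (2 · r ^ 2 + 2 · (r * s ^ 2) + s ^ 4) * (2 · (3 · r))
          ≈⟨ solve 6 (λ w r s t a b →
               w :^ 6 :* (b :+ t :^ 2 :+ r :^ 2 :* (3 :× r)) :+ w :^ 6 :* s :^ 2 :* (r :* (3 :× r) :+ s :^ 2 :* s :^ 2)
                 :+ w :^ 6 :* a :* (3 :× r :+ s :^ 2)
                 :+ w :^ 6 :* (2 :× (r :^ 2) :+ 2 :× (r :* s :^ 2) :+ s :^ 4) :* (2 :× (3 :× r))
               := w :^ 6 :* (b :+ r :* a :+ r :^ 3 :+ t :^ 2)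
                  :+ w :^ 2 :* (2 :× r :+ s :^ 2) :* (w :^ 4 :* (a :+ 3 :× (r :^ 2)))
                  :+ (w :^ 2 :* (2 :× r :+ s :^ 2)) :^ 3) refl w r s t E.A E.B ⟩
        w ^ 6 * (E.B + r * E.A + r ^ 3 + t ^ 2) + R * (w ^ 4 * (E.A + 3 · r ^ 2)) + R ^ 3
          ≈⟨ +≈ˡ _ (+-cong (sym B′≈) (*≈ʳ R (sym A′≈))) ⟩
        E′.B + R * E′.A + R ^ 3 ∎
    }
    where
    module E  = EllipticCurve E
    module E′ = EllipticCurve E′
    open _≅_ i
    open Facts i
    w R S T : Carrier
    w = u ⁻¹
    R = w ^ 2 * (2 · r + s ^ 2)
    S = w * s
    T = w ^ 3 * (r * s + t)
    2S≈0 : 2 · S ≈ 0#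
    2S≈0 = trans (solve 2 (λ w s → 2 :× (w :* s) := w :* (2 :× s)) refl w s) (*-zero w xy-coeff)
    X≈0 : r * s ^ 2 + 3 · r * s ^ 2 ≈ 0#
    X≈0 = trans (solve 2 (λ r s → r :* s :^ 2 :+ 3 :× r :* s :^ 2 := 2 :× (r :* s) :* (2 :× s)) refl r s)
                (*-zero _ xy-coeff)
    3r+s²≈0 : 3 · r + s ^ 2 ≈ 0#
    3r+s²≈0 = begin
      3 · r + s ^ 2   ≈⟨ +≈ˡ _ x²-coeff ⟩
      s ^ 2 + s ^ 2   ≈⟨ solve 1 (λ s → s :^ 2 :+ s :^ 2 := s :* (2 :× s)) refl s ⟩
      s * (2 · s)     ≈⟨ *-zero s xy-coeff ⟩
      0#              ∎
    A′≈ : E′.A ≈ w ^ 4 * (E.A + 3 · r ^ 2)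
    A′≈ = begin
      E′.A                     ≈⟨ sym (cancel^ 4 _ (inverseʳ u≉0)) ⟩
      (u * w) ^ 4 * E′.A       ≈⟨ solve 3 (λ u w a → (u :* w) :^ 4 :* a := w :^ 4 :* (u :^ 4 :* a)) refl u w E′.A ⟩
      w ^ 4 * (u ^ 4 * E′.A)   ≈⟨ *≈ʳ _ x-coeff′ ⟩
      w ^ 4 * (E.A + 3 · r ^ 2) ∎
    B′≈ : E′.B ≈ w ^ 6 * (E.B + r * E.A + r ^ 3 + t ^ 2)
    B′≈ = begin
      E′.B                     ≈⟨ sym (cancel^ 6 _ (inverseʳ u≉0)) ⟩
      (u * w) ^ 6 * E′.B       ≈⟨ solve 3 (λ u w a → (u :* w) :^ 6 :* a := w :^ 6 :* (u :^ 6 :* a)) refl u w E′.B ⟩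
      w ^ 6 * (u ^ 6 * E′.B)   ≈⟨ *≈ʳ _ 1-coeff′ ⟩
      w ^ 6 * (E.B + r * E.A + r ^ 3 + t ^ 2) ∎

  isomorphismSetoid : Setoid (c ⊔ ℓ) (c ⊔ ℓ)
  isomorphismSetoid = record
    { Carrier       = EllipticCurve F
    ; _≈_           = _≅_ F
    ; isEquivalence = record { refl = ≅-refl ; sym = ≅-sym ; trans = ≅-trans }
    }

  twist : (d : Carrier) → ¬ (d ≈ 0#) → EllipticCurve F → EllipticCurve F
  twist d d≉0 E = record
    { eqn         = equation (d ^ 2 * A) (d ^ 3 * B)
    ; nonsingular = λ Δ≈0 → *-nonzero (^-nonzero 6) nonsingular (begin
        d ^ 6 * (4 · A ^ 3 + 27 · B ^ 2)
          ≈⟨ solve 3 (λ d a b → d :^ 6 :* (4 :× (a :^ 3) :+ 27 :× (b :^ 2))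
                := 4 :× ((d :^ 2 :* a) :^ 3) :+ 27 :× ((d :^ 3 :* b) :^ 2)) refl d A B ⟩
        4 · (d ^ 2 * A) ^ 3 + 27 · (d ^ 3 * B) ^ 2
          ≈⟨ Δ≈0 ⟩
        0# ∎)
    }
    where
    open EllipticCurve E
    ^-nonzero : ∀ n → ¬ (d ^ n ≈ 0#)
    ^-nonzero zero    = 1≉0
    ^-nonzero (suc n) = *-nonzero d≉0 (^-nonzero n)

  HasRationalPointOfOrder : ℕ → EllipticCurve F → Set (c ⊔ ℓ)
  HasRationalPointOfOrder n E = ∃[ P ] OnCurve P × HasOrder P n
    where open GroupLaw F (EllipticCurve.eqn E)

  -- ≈ on this setoid is isomorphism of the underlying curves.
  curvesWithRationalPointOfOrder : ℕ → Setoid (c ⊔ ℓ) (c ⊔ ℓ)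
  curvesWithRationalPointOfOrder n =
    On.setoid {B = Σ (EllipticCurve F) (HasRationalPointOfOrder n)}
              isomorphismSetoid proj₁

module Geometric {c ℓ c′ ℓ′} (F : Field c ℓ) (F̄ : AlgebraicClosure F c′ ℓ′) where
  open AlgebraicClosure F̄ using (ι) renaming (closure to K)
  open Curves F using (isomorphismSetoid)

  baseChange : Equation F → Equation K
  baseChange (equation A B) = equation (ι A) (ι B)

  ιₚ : Point F → Point K
  ιₚ 𝒪         = 𝒪
  ιₚ (aff x y) = aff (ι x) (ι y)

  DefinedOverBase : Point K → Set (c ⊔ c′ ⊔ ℓ′)
  DefinedOverBase P = ∃[ Q ] ιₚ Q ≈ₚ P
    where open Points K

  -- q is to be the cardinality of F.
  record RationalSubgroupWithIrrationalPoints (q n : ℕ) (E : EllipticCurve F)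
         : Set (c ⊔ lsuc (c′ ⊔ ℓ′)) where
    open GroupLaw K (baseChange (EllipticCurve.eqn E))
    field
      G                : Pred (Point K) (c′ ⊔ ℓ′)
      isSubgroup       : IsSubgroup G
      order            : HasCardinality (subsetSetoid G) n
      frobenius-stable : ∀ {P} → G P → G (frobenius q P)
      irrational       : ∀ {P} → G P → ¬ (P ≈ₚ 𝒪) → ¬ DefinedOverBase P

  curvesWithRationalSubgroupWithIrrationalPoints :
    ℕ → ℕ → Setoid (c ⊔ ℓ ⊔ lsuc (c′ ⊔ ℓ′)) (c ⊔ ℓ)
  curvesWithRationalSubgroupWithIrrationalPoints q n =
    On.setoid {B = Σ (EllipticCurve F) (RationalSubgroupWithIrrationalPoints q n)}
              isomorphismSetoid proj₁

module Submission where

-- In characteristic not 2 or 3, a point (x , y) of y² = x³ + Ax + B has order 3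
-- iff y ≠ 0 and (3x² + A)² = 3x (2y)², and a subgroup of order 3 is {𝒪, ±(x , y)}
-- for such a point.  With s² = t, the twist is isomorphic to the curve over 𝔽_q(s)
-- by (x , y) ↦ (s²x , s³y).  This carries a rational point of order 3 to one whose
-- x is rational and whose y is not, because s is not.  Conversely, an element z
-- outside 𝔽_q with z² in 𝔽_q satisfies z^q = - z, so if neither s nor y is in 𝔽_q
-- then s y is, and the image (s²x , s² · sy) is a rational point.  Twisting twice by
-- t multiplies A by t⁴ and B by t⁶, which does not change the isomorphism class.
-- The congruence on q excludes characteristic 3, as q · 1 = 0 in 𝔽_q.

-- The flex condition is stated with the denominator 2y cleared. It is then polynomial in A, B, x,
-- y, so scaling by `s` and `ι` both preserve it and `ι` reflects it; order 3 passes between the two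
-- fields and the two curves without comparing their addition laws. A subgroup here is a predicate
-- with three elements, closed under the chord-tangent formulas. That it contains a flex is drawn
-- from this closure: if some element has y ≠ 0, its negative and its double have nowhere else to
-- go, and if both nonzero elements had y = 0, their sum would force a double root of the cubic. The
-- sign in z^q = - z comes from (z^q)² = z² once 𝔽_q is known to be the whole fixed set of the
-- q-power map. That in turn is a count: every element of 𝔽_q is a root of X^q - X, which leaves no
-- room for another root in the closure.

open import Defs
open import Algebra.Bundles using (CommutativeMonoid; CommutativeRing; RawRing)
open import Algebra.Morphism.Structures using (module RingMorphisms)
import Algebra.Properties.AbelianGroup as AbelianGroupProperties
import Algebra.Properties.CommutativeMonoid.Sum as Sum
import Algebra.Properties.CommutativeSemiring.Exp as CommutativeExp
import Algebra.Properties.Group as GroupProperties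
import Algebra.Properties.Ring as RingProperties
import Algebra.Properties.Semiring.Exp as Exp
import Algebra.Properties.Semiring.Mult as Mult
import Algebra.Properties.Semiring.Mult.TCOptimised as OptimisedMult
import Algebra.Solver.Ring as RingSolver
open import Algebra.Solver.Ring.AlmostCommutativeRing
  using (_-Raw-AlmostCommutative⟶_; fromCommutativeRing)
import Algebra.Solver.Ring.NaturalCoefficients.Default as NaturalSolver
open import Data.Fin.Base using (Fin; zero; suc; punchIn; punchOut)
open import Data.Fin.Patterns using (0F; 1F; 2F)
open import Data.Fin.Permutation using (Permutation; permutation)
import Data.Fin.Properties as Finₚ
open import Data.Maybe.Base using (Maybe; just; nothing)
open import Data.Nat.Base as ℕ using (ℕ; zero; suc; z≤n; s≤s; _%_; _/_)
import Data.Nat.DivMod as DivMod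
import Data.Nat.Properties as ℕₚ
open import Data.Product.Base using (Σ; Σ-syntax; ∃-syntax; _×_; _,_; proj₁; proj₂)
open import Data.Sum.Base using (_⊎_; inj₁; inj₂; [_,_]′; map₂) renaming (swap to swap-⊎)
open import Data.Unit.Polymorphic.Base using (tt)
open import Data.Vec.Base using (Vec; []; _∷_; replicate)
open import Function.Base using (_∘_; id)
open import Function.Bundles using (Bijection; Inverse)
open import Level using (_⊔_)
open import Relation.Binary.Bundles using (Setoid)
open import Relation.Binary.PropositionalEquality as ≡ using (_≡_)
import Relation.Binary.Reasoning.Setoid as SetoidReasoning
open import Relation.Nullary using (¬_; Dec; yes; no; contradiction)
open import Relation.Unary using (Pred)

-- The library has ring solvers with coefficients in ℕ or in the ring itself,
-- neither of which cancels x - x; here (a , b) stands for the integer a - b,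
-- and one of a and b is kept at 0 so that normal forms are unique.
module DifferenceSolver {c ℓ} (R : CommutativeRing c ℓ) where
  open CommutativeRing R
  open AbelianGroupProperties +-abelianGroup
    using () renaming (⁻¹-∙-comm to -‿+-comm; ⁻¹-anti-homo‿- to -‿anti-homo)
  open RingProperties ring using (-‿distribˡ-*; -‿distribʳ-*)
  open OptimisedMult semiring
    using (×-homo-+; ×1-homo-*) renaming (_×_ to _·′_)
  open NaturalSolver commutativeSemiring using (solve; _:=_; _:+_; _:*_)
  open SetoidReasoning setoid

  private
    reduce : ℕ → ℕ → ℕ × ℕ
    reduce a b = a ℕ.∸ b , b ℕ.∸ a

    coefficients : RawRing _ _
    coefficients = record
      { Carrier = ℕ × ℕ
      ; _≈_     = _≡_
      ; _+_     = λ (a , b) (c , d) → reduce (a ℕ.+ c) (b ℕ.+ d)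
      ; _*_     = λ (a , b) (c , d) → reduce (a ℕ.* c ℕ.+ b ℕ.* d) (a ℕ.* d ℕ.+ b ℕ.* c)
      ; -_      = λ (a , b) → b , a
      ; 0#      = 0 , 0
      ; 1#      = 1 , 0
      }
    module C = RawRing coefficients

    ν : ℕ → Carrier
    ν n = n ·′ 1#

    -- The split makes con (0 , 0) and con (1 , 0) denote 0# and 1# on the nose.
    value : ℕ × ℕ → Carrier
    value (a , zero)  = ν a
    value (a , suc b) = ν a - ν (suc b)

    value≈ : ∀ a b → value (a , b) ≈ ν a - ν b
    value≈ a zero    = sym (trans (+-congˡ (trans (sym (+-identityˡ _)) (-‿inverseʳ 0#))) (+-identityʳ _))
    value≈ a (suc b) = refl

    -- Equal cross sums mean equal integers: each difference is padded by the negative part of the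
    -- other.
    value-cong : ∀ a b c d → a ℕ.+ d ≡ c ℕ.+ b → value (a , b) ≈ value (c , d)
    value-cong a b c d eq = begin
      value (a , b)                ≈⟨ value≈ a b ⟩
      ν a - ν b                    ≈⟨ sym (pad (ν a) (ν b) (ν d)) ⟩
      (ν a + ν d) - (ν b + ν d)    ≈⟨ +-cong ν≈ (-‿cong (+-comm _ _)) ⟩
      (ν c + ν b) - (ν d + ν b)    ≈⟨ pad (ν c) (ν d) (ν b) ⟩
      ν c - ν d                    ≈⟨ sym (value≈ c d) ⟩
      value (c , d)                ∎
      where
      ν≈ : ν a + ν d ≈ ν c + ν b
      ν≈ = trans (sym (×-homo-+ 1# a d))
                 (trans (reflexive (≡.cong ν eq)) (×-homo-+ 1# c b))
      pad : ∀ x y z → (x + z) - (y + z) ≈ x - y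
      pad x y z = begin
        (x + z) - (y + z)       ≈⟨ +-congˡ (sym (-‿+-comm y z)) ⟩
        (x + z) + (- y - z)     ≈⟨ solve 4 (λ x z y′ z′ → (x :+ z) :+ (y′ :+ z′) := (x :+ y′) :+ (z :+ z′)) refl x z (- y) (- z) ⟩
        (x - y) + (z - z)       ≈⟨ trans (+-congˡ (-‿inverseʳ z)) (+-identityʳ _) ⟩
        x - y                   ∎

    value-reduce : ∀ a b → value (reduce a b) ≈ ν a - ν b
    value-reduce a b = trans (value-cong (a ℕ.∸ b) (b ℕ.∸ a) a b (balanced a b))
      (value≈ a b)
      where
      balanced : ∀ a b → a ℕ.∸ b ℕ.+ b ≡ a ℕ.+ (b ℕ.∸ a)
      balanced zero    zero    = ≡.refl
      balanced zero    (suc b) = ≡.refl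
      balanced (suc a) zero    = ≡.refl
      balanced (suc a) (suc b) = ≡.trans (ℕₚ.+-suc _ b) (≡.cong suc (balanced a b))

    +-homo : ∀ p r → value (p C.+ r) ≈ value p + value r
    +-homo (a , b) (c , d) = begin
      value ((a , b) C.+ (c , d))      ≈⟨ value-reduce (a ℕ.+ c) (b ℕ.+ d) ⟩
      ν (a ℕ.+ c) - ν (b ℕ.+ d)        ≈⟨ +-cong (×-homo-+ 1# a c) (-‿cong (×-homo-+ 1# b d)) ⟩
      ν a + ν c - (ν b + ν d)          ≈⟨ +-congˡ (sym (-‿+-comm (ν b) (ν d))) ⟩
      ν a + ν c + (- ν b - ν d)        ≈⟨ solve 4 (λ a c b d → a :+ c :+ (b :+ d) := a :+ b :+ (c :+ d)) refl (ν a) (ν c) (- ν b) (- ν d) ⟩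
      (ν a - ν b) + (ν c - ν d)        ≈⟨ sym (+-cong (value≈ a b) (value≈ c d)) ⟩
      value (a , b) + value (c , d)    ∎

    *-homo : ∀ p r → value (p C.* r) ≈ value p * value r
    *-homo (a , b) (c , d) = begin
      value ((a , b) C.* (c , d))
        ≈⟨ value-reduce (a ℕ.* c ℕ.+ b ℕ.* d) (a ℕ.* d ℕ.+ b ℕ.* c) ⟩
      ν (a ℕ.* c ℕ.+ b ℕ.* d) - ν (a ℕ.* d ℕ.+ b ℕ.* c)
        ≈⟨ +-cong (homo a c b d) (-‿cong (homo a d b c)) ⟩
      (ν a * ν c + ν b * ν d) - (ν a * ν d + ν b * ν c)
        ≈⟨ +-cong (+-congˡ -b*-d) (sym (-‿+-comm _ _)) ⟩
      (ν a * ν c + - ν b * - ν d) + (- (ν a * ν d) - ν b * ν c)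
        ≈⟨ +-congˡ (+-cong (-‿distribʳ-* (ν a) (ν d)) (-‿distribˡ-* (ν b) (ν c))) ⟩
      (ν a * ν c + - ν b * - ν d) + (ν a * - ν d + - ν b * ν c)
        ≈⟨ solve 4 (λ a b c d → (a :* c :+ b :* d) :+ (a :* d :+ b :* c) := (a :+ b) :* (c :+ d)) refl (ν a) (- ν b) (ν c) (- ν d) ⟩
      (ν a - ν b) * (ν c - ν d)
        ≈⟨ sym (*-cong (value≈ a b) (value≈ c d)) ⟩
      value (a , b) * value (c , d)    ∎
      where
      homo : ∀ a b c d → ν (a ℕ.* b ℕ.+ c ℕ.* d) ≈ ν a * ν b + ν c * ν d
      homo a b c d = trans (×-homo-+ 1# (a ℕ.* b) (c ℕ.* d)) (+-cong (×1-homo-* a b) (×1-homo-* c d))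
      -b*-d : ν b * ν d ≈ - ν b * - ν d
      -b*-d = begin
        ν b * ν d             ≈⟨ sym (⁻¹-involutive _) ⟩
        - - (ν b * ν d)       ≈⟨ -‿cong (-‿distribʳ-* (ν b) (ν d)) ⟩
        - (ν b * - ν d)       ≈⟨ -‿distribˡ-* (ν b) (- ν d) ⟩
        - ν b * - ν d         ∎
        where open AbelianGroupProperties +-abelianGroup using (⁻¹-involutive)

    homomorphism : coefficients -Raw-AlmostCommutative⟶ fromCommutativeRing R
    homomorphism = record
      { ⟦_⟧    = value
      ; +-homo = +-homo
      ; *-homo = *-homo
      ; -‿homo = λ (a , b) → trans (value≈ b a)
                   (trans (sym (-‿anti-homo (ν a) (ν b))) (-‿cong (sym (value≈ a b))))
      ; 0-homo = refl
      ; 1-homo = refl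
      }

    _≟_ : ∀ p r → Maybe (value p ≈ value r)
    (a , b) ≟ (c , d) with a ℕ.+ d ℕₚ.≟ c ℕ.+ b
    ... | yes eq = just (value-cong a b c d eq)
    ... | no _   = nothing

  open RingSolver coefficients (fromCommutativeRing R) homomorphism _≟_ public
    using (con; _:=_; _:+_; _:*_; _:-_; :-_; _:×_; _:^_)
    renaming (solve to solveᵣ)

  :0 :1 : ∀ {n} → RingSolver.Polynomial coefficients (fromCommutativeRing R) homomorphism _≟_ n
  :0 = con (0 , 0)
  :1 = con (1 , 0)

-- Cancellation, square roots and integer multiples in a discrete field.

module FieldProperties {c ℓ} (K : Field c ℓ) where
  open Field K
  open DifferenceSolver commutativeRing
  open SetoidReasoning setoid
  open GroupProperties +-group public
    using () renaming (x∙y⁻¹≈ε⇒x≈y to x-y≈0⇒x≈y; x≈y⇒x∙y⁻¹≈ε to x≈y⇒x-y≈0)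
  open Exp semiring public using (^-congˡ; ^-assocʳ)
  open Mult semiring public using (×1-homo-*; ×-homo-+) renaming (×-congʳ to ·-congʳ)

  *-cancelˡ : ∀ {x y z} → ¬ x ≈ 0# → x * y ≈ x * z → y ≈ z
  *-cancelˡ {x} {y} {z} x≉0 xy≈xz = trans (sym (x⁻¹xw≈w y)) (trans (*-congˡ xy≈xz) (x⁻¹xw≈w z))
    where
    x⁻¹xw≈w : ∀ w → x ⁻¹ * (x * w) ≈ w
    x⁻¹xw≈w w = begin
      x ⁻¹ * (x * w)  ≈⟨ solveᵣ 3 (λ i x w → i :* (x :* w) := x :* i :* w) refl (x ⁻¹) x w ⟩
      x * x ⁻¹ * w    ≈⟨ *-congʳ (inverseʳ x≉0) ⟩
      1# * w          ≈⟨ *-identityˡ w ⟩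
      w               ∎

  *-nonzero : ∀ {x y} → ¬ x ≈ 0# → ¬ y ≈ 0# → ¬ x * y ≈ 0#
  *-nonzero x≉0 y≉0 xy≈0 = y≉0 (*-cancelˡ x≉0 (trans xy≈0 (sym (zeroʳ _))))

  ^-nonzero : ∀ {x} n → ¬ x ≈ 0# → ¬ x ^ n ≈ 0#
  ^-nonzero zero    x≉0 = 1≉0
  ^-nonzero (suc n) x≉0 = *-nonzero x≉0 (^-nonzero n x≉0)

  zero-product : ∀ {x y} → x * y ≈ 0# → x ≈ 0# ⊎ y ≈ 0#
  zero-product {x} xy≈0 with x ≟ 0#
  ... | yes x≈0 = inj₁ x≈0
  ... | no  x≉0 = inj₂ (*-cancelˡ x≉0 (trans xy≈0 (sym (zeroʳ _))))

  -- An identity a ≈ b + k * (l - r) of polynomials gives a ≈ b modulo l ≈ r.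
  modulo : ∀ {l r} → l ≈ r → ∀ b k → b + k * (l - r) ≈ b
  modulo l≈r b k = trans (+-congˡ (trans (*-congˡ (x≈y⇒x-y≈0 l≈r)) (zeroʳ k))) (+-identityʳ b)

  squares-equal : ∀ {x y} → x ^ 2 ≈ y ^ 2 → x ≈ y ⊎ x ≈ - y
  squares-equal {x} {y} x²≈y² = [ inj₁ ∘ x-y≈0⇒x≈y x y , inj₂ ∘ x+y≈0⇒x≈-y ]′ (zero-product factors)
    where
    factors : (x - y) * (x + y) ≈ 0#
    factors = begin
      (x - y) * (x + y)             ≈⟨ solveᵣ 2 (λ x y → (x :- y) :* (x :+ y) := :0 :+ :1 :* (x :^ 2 :- y :^ 2)) refl x y ⟩
      0# + 1# * (x ^ 2 - y ^ 2)     ≈⟨ modulo x²≈y² 0# 1# ⟩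
      0#                            ∎
    x+y≈0⇒x≈-y : x + y ≈ 0# → x ≈ - y
    x+y≈0⇒x≈-y x+y≈0 = begin
      x                ≈⟨ solveᵣ 2 (λ x y → x := :- y :+ (x :+ y)) refl x y ⟩
      - y + (x + y)    ≈⟨ +-congˡ x+y≈0 ⟩
      - y + 0#         ≈⟨ +-identityʳ _ ⟩
      - y              ∎

  x≈-y⇒-x≈y : ∀ {x y} → x ≈ - y → - x ≈ y
  x≈-y⇒-x≈y {x} {y} p = trans (-‿cong p) (solveᵣ 1 (λ y → :- (:- y) := y) refl y)

  ·-nonzero : ∀ n {x} → ¬ n · 1# ≈ 0# → ¬ x ≈ 0# → ¬ n · x ≈ 0#
  ·-nonzero n {x} n≉0 x≉0 nx≈0 = *-nonzero n≉0 x≉0 (begin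
    n · 1# * x     ≈⟨ ×-assoc-* n 1# x ⟩
    n · (1# * x)   ≈⟨ ·-congʳ n (*-identityˡ x) ⟩
    n · x          ≈⟨ nx≈0 ⟩
    0#             ∎)
    where open Mult semiring using (×-assoc-*)

  ·-zero : ∀ n {x} → ¬ n · 1# ≈ 0# → n · x ≈ 0# → x ≈ 0#
  ·-zero n {x} n≉0 nx≈0 with x ≟ 0#
  ... | yes x≈0 = x≈0
  ... | no x≉0  = contradiction nx≈0 (·-nonzero n n≉0 x≉0)

-- Flexes, and their behaviour under negation and scaling.

module OrderThree {c ℓ} (K : Field c ℓ) (2≉0 : ¬ Field._≈_ K (Field._·_ K 2 (Field.1# K)) (Field.0# K)) where
  open Field K
  open FieldProperties K
  open DifferenceSolver commutativeRing
  open SetoidReasoning setoid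

  -- With m = (3x² + A) / 2y the slope of the tangent at (x , y), the last
  -- condition says m² = 3x: the tangent meets the curve only at (x , y).
  record IsFlex (A B x y : Carrier) : Set ℓ where
    field
      onCurve : y ^ 2 ≈ x ^ 3 + A * x + B
      y≉0     : ¬ y ≈ 0#
      flex    : (3 · x ^ 2 + A) ^ 2 ≈ 3 · x * (2 · y) ^ 2

  slope : (A x y : Carrier) → Carrier
  slope A x y = (3 · x ^ 2 + A) * (2 · y) ⁻¹

  slope-eq : ∀ A x {y} → ¬ y ≈ 0# → 2 · y * slope A x y ≈ 3 · x ^ 2 + A
  slope-eq A x {y} y≉0 = begin
    2 · y * ((3 · x ^ 2 + A) * (2 · y) ⁻¹)   ≈⟨ solveᵣ 3 (λ d n i → d :* (n :* i) := n :* (d :* i)) refl (2 · y) (3 · x ^ 2 + A) ((2 · y) ⁻¹) ⟩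
    (3 · x ^ 2 + A) * (2 · y * (2 · y) ⁻¹)   ≈⟨ *-congˡ (inverseʳ (·-nonzero 2 2≉0 y≉0)) ⟩
    (3 · x ^ 2 + A) * 1#                     ≈⟨ *-identityʳ _ ⟩
    3 · x ^ 2 + A                            ∎

  flex⇒slope² : ∀ {A B x y} → IsFlex A B x y → slope A x y ^ 2 ≈ 3 · x
  flex⇒slope² {A} {B} {x} {y} f = *-cancelˡ (^-nonzero 2 (·-nonzero 2 2≉0 y≉0)) (begin
    (2 · y) ^ 2 * m ^ 2    ≈⟨ solveᵣ 2 (λ d m → d :^ 2 :* m :^ 2 := (d :* m) :^ 2) refl (2 · y) m ⟩
    (2 · y * m) ^ 2        ≈⟨ ^-congˡ 2 (slope-eq A x y≉0) ⟩
    (3 · x ^ 2 + A) ^ 2    ≈⟨ flex ⟩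
    3 · x * (2 · y) ^ 2    ≈⟨ *-comm _ _ ⟩
    (2 · y) ^ 2 * (3 · x)  ∎)
    where
    open IsFlex f
    m = slope A x y

  slope²⇒flex : ∀ A x {y} → ¬ y ≈ 0# → slope A x y ^ 2 ≈ 3 · x →
                (3 · x ^ 2 + A) ^ 2 ≈ 3 · x * (2 · y) ^ 2
  slope²⇒flex A x {y} y≉0 m²≈3x = begin
    (3 · x ^ 2 + A) ^ 2    ≈⟨ ^-congˡ 2 (sym (slope-eq A x y≉0)) ⟩
    (2 · y * m) ^ 2        ≈⟨ solveᵣ 2 (λ d m → (d :* m) :^ 2 := m :^ 2 :* d :^ 2) refl (2 · y) m ⟩
    m ^ 2 * (2 · y) ^ 2    ≈⟨ *-congʳ m²≈3x ⟩
    3 · x * (2 · y) ^ 2    ∎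
    where m = slope A x y

  flex-cong : ∀ {A A′ B B′ x x′ y y′} → A ≈ A′ → B ≈ B′ → x ≈ x′ → y ≈ y′ →
              IsFlex A B x y → IsFlex A′ B′ x′ y′
  flex-cong a b p q f = record
    { onCurve = trans (^-congˡ 2 (sym q)) (trans onCurve (+-cong (+-cong (^-congˡ 3 p) (*-cong a p)) b))
    ; y≉0     = λ y′≈0 → y≉0 (trans q y′≈0)
    ; flex    = trans (^-congˡ 2 (+-cong (·-congʳ 3 (^-congˡ 2 (sym p))) (sym a)))
                  (trans flex (*-cong (·-congʳ 3 p) (^-congˡ 2 (·-congʳ 2 q))))
    }
    where open IsFlex f

  -‿nonzero : ∀ {y} → ¬ y ≈ 0# → ¬ - y ≈ 0#
  -‿nonzero {y} y≉0 p = y≉0 (begin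
    y          ≈⟨ solveᵣ 1 (λ y → y := :- (:- y)) refl y ⟩
    - (- y)    ≈⟨ -‿cong p ⟩
    - 0#       ≈⟨ solveᵣ 0 (:- :0 := :0) refl ⟩
    0#         ∎)

  flex-neg : ∀ {A B x y} → IsFlex A B x y → IsFlex A B x (- y)
  flex-neg {A} {B} {x} {y} f = record
    { onCurve = trans (solveᵣ 1 (λ y → (:- y) :^ 2 := y :^ 2) refl y) onCurve
    ; y≉0     = -‿nonzero y≉0
    ; flex    = trans flex (solveᵣ 2 (λ x y → 3 :× x :* (2 :× y) :^ 2 := 3 :× x :* (2 :× (:- y)) :^ 2) refl x y)
    }
    where open IsFlex f

  -- Give x, y, A, B the weights 2, 3, 4, 6: the curve equation is homogeneous of weight 6 and the
  -- flex equation of weight 8. With s² = t these are the coefficients of the twist.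
  flex-scale : ∀ {A B x y s} → ¬ s ≈ 0# → IsFlex A B x y →
               IsFlex (s ^ 4 * A) (s ^ 6 * B) (s ^ 2 * x) (s ^ 3 * y)
  flex-scale {A} {B} {x} {y} {s} s≉0 f = record
    { onCurve = begin
        (s ^ 3 * y) ^ 2                   ≈⟨ solveᵣ 2 (λ s y → (s :^ 3 :* y) :^ 2 := s :^ 6 :* y :^ 2) refl s y ⟩
        s ^ 6 * y ^ 2                     ≈⟨ *-congˡ onCurve ⟩
        s ^ 6 * (x ^ 3 + A * x + B)       ≈⟨ solveᵣ 4 (λ s x A B → s :^ 6 :* (x :^ 3 :+ A :* x :+ B)
                                               := (s :^ 2 :* x) :^ 3 :+ s :^ 4 :* A :* (s :^ 2 :* x) :+ s :^ 6 :* B) refl s x A B ⟩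
        (s ^ 2 * x) ^ 3 + s ^ 4 * A * (s ^ 2 * x) + s ^ 6 * B ∎
    ; y≉0     = *-nonzero (^-nonzero 3 s≉0) y≉0
    ; flex    = begin
        (3 · (s ^ 2 * x) ^ 2 + s ^ 4 * A) ^ 2    ≈⟨ solveᵣ 3 (λ s x A → (3 :× (s :^ 2 :* x) :^ 2 :+ s :^ 4 :* A) :^ 2
                                                     := s :^ 8 :* (3 :× x :^ 2 :+ A) :^ 2) refl s x A ⟩
        s ^ 8 * (3 · x ^ 2 + A) ^ 2              ≈⟨ *-congˡ flex ⟩
        s ^ 8 * (3 · x * (2 · y) ^ 2)            ≈⟨ solveᵣ 3 (λ s x y → s :^ 8 :* (3 :× x :* (2 :× y) :^ 2)
                                                     := 3 :× (s :^ 2 :* x) :* (2 :× (s :^ 3 :* y)) :^ 2) refl s x y ⟩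
        3 · (s ^ 2 * x) * (2 · (s ^ 3 * y)) ^ 2  ∎
    }
    where open IsFlex f

  y≉-y : ∀ {y} → ¬ y ≈ 0# → ¬ y ≈ - y
  y≉-y {y} y≉0 p = ·-nonzero 2 2≉0 y≉0 (begin
    2 · y                       ≈⟨ solveᵣ 1 (λ y → 2 :× y := :0 :+ :1 :* (y :- :- y)) refl y ⟩
    0# + 1# * (y - - y)         ≈⟨ modulo p 0# 1# ⟩
    0#                          ∎)

  -- Points and subgroups of order 3 on a fixed curve.

  module OnEquation (E : Equation K) where
    open Equation E
    open GroupLaw K E

    aff≉𝒪 : ∀ {x y} → ¬ aff x y ≈ₚ 𝒪
    aff≉𝒪 ()

    -- This and the next two lemmas resolve the case split of `_⊕_` once, as propositional
    -- equations, so that later proofs rewrite sums with `≡.subst` instead of repeating the split.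
    ⊕-opposite : ∀ {x₁ y₁ x₂ y₂} → x₁ ≈ x₂ → y₁ ≈ - y₂ → aff x₁ y₁ ⊕ aff x₂ y₂ ≡ 𝒪
    ⊕-opposite {x₁} {y₁} {x₂} {y₂} p r with x₁ ≟ x₂ | y₁ ≟ (- y₂)
    ... | yes _ | yes _ = ≡.refl
    ... | no ¬p | _     = contradiction p ¬p
    ... | yes _ | no ¬r = contradiction r ¬r

    ⊕-tangent : ∀ {x₁ y₁ x₂ y₂} → x₁ ≈ x₂ → ¬ y₁ ≈ - y₂ →
                aff x₁ y₁ ⊕ aff x₂ y₂ ≡ lineSum (slope A x₁ y₁) x₁ y₁ x₂
    ⊕-tangent {x₁} {y₁} {x₂} {y₂} p ¬r with x₁ ≟ x₂ | y₁ ≟ (- y₂)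
    ... | yes _ | no _  = ≡.refl
    ... | no ¬p | _     = contradiction p ¬p
    ... | yes _ | yes r = contradiction r ¬r

    ⊕-chord : ∀ {x₁ y₁ x₂ y₂} → ¬ x₁ ≈ x₂ →
              aff x₁ y₁ ⊕ aff x₂ y₂ ≡ lineSum ((y₂ - y₁) * (x₂ - x₁) ⁻¹) x₁ y₁ x₂
    ⊕-chord {x₁} {y₁} {x₂} {y₂} ¬p with x₁ ≟ x₂ | y₁ ≟ (- y₂)
    ... | no _  | _ = ≡.refl
    ... | yes p | _ = contradiction p ¬p

    ⊕≈𝒪⇒x≈ : ∀ {x₁ y₁ x₂ y₂} → aff x₁ y₁ ⊕ aff x₂ y₂ ≈ₚ 𝒪 → x₁ ≈ x₂
    ⊕≈𝒪⇒x≈ {x₁} {y₁} {x₂} {y₂} e with x₁ ≟ x₂ | y₁ ≟ (- y₂) | e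
    ... | yes p | _ | _  = p
    ... | no _  | _ | ()

    -- The abscissa of the sum collapses to 3x - 2x. A separate `x′` serves sums of two points whose
    -- abscissas agree only up to `_≈_`.
    flex⇒lineSum : ∀ {x y x′} → IsFlex A B x y → x ≈ x′ →
                   lineSum (slope A x y) x y x′ ≈ₚ aff x (- y)
    flex⇒lineSum {x} {y} {x′} f x≈x′ = aff≈ x₃≈x (begin
      m * (x - x₃) - y     ≈⟨ +-congʳ (*-congˡ (x≈y⇒x-y≈0 (sym x₃≈x))) ⟩
      m * 0# - y           ≈⟨ solveᵣ 2 (λ m y → m :* :0 :- y := :- y) refl m y ⟩
      - y                  ∎)
      where
      m = slope A x y
      x₃ = m ^ 2 - x - x′
      x₃≈x : x₃ ≈ x
      x₃≈x = begin
        m ^ 2 - x - x′     ≈⟨ +-cong (+-congʳ (flex⇒slope² f)) (-‿cong (sym x≈x′)) ⟩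
        3 · x - x - x      ≈⟨ solveᵣ 1 (λ x → 3 :× x :- x :- x := x) refl x ⟩
        x                  ∎

    tangent-x⇒flex : ∀ {x y} → OnCurve (aff x y) → ¬ y ≈ 0# →
                     slope A x y ^ 2 - x - x ≈ x → IsFlex A B x y
    tangent-x⇒flex {x} {y} on y≉0 x₃≈x = record
      { onCurve = on ; y≉0 = y≉0
      ; flex = slope²⇒flex A x y≉0 (begin
          m ^ 2                                  ≈⟨ solveᵣ 2 (λ M x → M := 3 :× x :+ :1 :* (M :- x :- x :- x)) refl (m ^ 2) x ⟩
          3 · x + 1# * (m ^ 2 - x - x - x)       ≈⟨ modulo x₃≈x (3 · x) 1# ⟩
          3 · x                                  ∎)
      }
      where m = slope A x y

    -- `3 ·ₚ P` reduces to `P ⊕ (P ⊕ P)`, and a sum can vanish only between points of equal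
    -- abscissa, so doubling keeps x. If y were 0, already `2 ·ₚ P` would vanish.
    order3⇒flex : ∀ {x y} → OnCurve (aff x y) → HasOrder (aff x y) 3 → IsFlex A B x y
    order3⇒flex {x} {y} on (3P≈𝒪 , minimal) = tangent-x⇒flex on y≉0 (sym (⊕≈𝒪⇒x≈
      (≡.subst (λ Q → aff x y ⊕ Q ≈ₚ 𝒪) (⊕-tangent refl (y≉-y y≉0)) 3P≈𝒪)))
      where
      y≉0 : ¬ y ≈ 0#
      y≉0 y≈0 = minimal 2 (s≤s z≤n) (s≤s (s≤s (s≤s z≤n)))
        (≡.subst (_≈ₚ 𝒪) (≡.sym (⊕-opposite refl (begin
          y                 ≈⟨ y≈0 ⟩
          0#                ≈⟨ solveᵣ 0 (:0 := :- :0) refl ⟩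
          - 0#              ≈⟨ -‿cong (sym y≈0) ⟩
          - y               ∎))) 𝒪≈)

    flex⇒order3 : ∀ {x y} → IsFlex A B x y → HasOrder (aff x y) 3
    flex⇒order3 {x} {y} f = 3P≈𝒪 , minimal
      where
      2P≡ = ⊕-tangent (refl {x}) (y≉-y (IsFlex.y≉0 f))
      opposite-sum : ∀ {Q} → Q ≈ₚ aff x (- y) → aff x y ⊕ Q ≈ₚ 𝒪
      opposite-sum (aff≈ x₃≈x y₃≈-y) =
        ≡.subst (_≈ₚ 𝒪) (≡.sym (⊕-opposite (sym x₃≈x) (sym (x≈-y⇒-x≈y y₃≈-y)))) 𝒪≈
      3P≈𝒪 : aff x y ⊕ (aff x y ⊕ aff x y) ≈ₚ 𝒪
      3P≈𝒪 = ≡.subst (λ Q → aff x y ⊕ Q ≈ₚ 𝒪) (≡.sym 2P≡) (opposite-sum (flex⇒lineSum f refl))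
      minimal : ∀ m → 0 ℕ.< m → m ℕ.< 3 → ¬ m ·ₚ aff x y ≈ₚ 𝒪
      minimal 0 () _
      minimal 1 _ _ ()
      minimal 2 _ _ e = aff≉𝒪 (≡.subst (_≈ₚ 𝒪) 2P≡ e)
      minimal (suc (suc (suc _))) _ (s≤s (s≤s (s≤s ())))

    -- The sign is kept as a choice so that the bijection with `Fin 3` can be read off a membership
    -- proof.
    data Triple (x y : Carrier) : Pred (Point K) (c ⊔ ℓ) where
      neutral : Triple x y 𝒪
      ±point  : ∀ {x′ y′} → x′ ≈ x → y′ ≈ y ⊎ y′ ≈ - y → Triple x y (aff x′ y′)

    triple-flex : ∀ {x y x′ y′} → IsFlex A B x y → x′ ≈ x → y′ ≈ y ⊎ y′ ≈ - y → IsFlex A B x′ y′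
    triple-flex f p (inj₁ r) = flex-cong refl refl (sym p) (sym r) f
    triple-flex f p (inj₂ r) = flex-cong refl refl (sym p) (sym r) (flex-neg f)

    sign-flip : ∀ {y y′} → y′ ≈ y ⊎ y′ ≈ - y → - y′ ≈ y ⊎ - y′ ≈ - y
    sign-flip (inj₁ r) = inj₂ (-‿cong r)
    sign-flip (inj₂ r) = inj₁ (x≈-y⇒-x≈y r)

    -- All affine members share one abscissa, so no sum is a chord: it is 𝒪 or a doubling, and
    -- doubling a flex negates it.
    triple-isSubgroup : ∀ {x y} → IsFlex A B x y → IsSubgroup (Triple x y)
    triple-isSubgroup {x} {y} f = record
      { respects   = respects
      ; onCurve    = onCurve
      ; 𝒪∈         = neutral
      ; ⊕-closed   = ⊕-closed
      ; neg-closed = λ { neutral → neutral ; (±point p r) → ±point p (sign-flip r) }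
      }
      where
      respects : ∀ {P Q} → P ≈ₚ Q → Triple x y P → Triple x y Q
      respects 𝒪≈         neutral             = neutral
      respects (aff≈ a b) (±point p (inj₁ r)) = ±point (trans (sym a) p) (inj₁ (trans (sym b) r))
      respects (aff≈ a b) (±point p (inj₂ r)) = ±point (trans (sym a) p) (inj₂ (trans (sym b) r))
      onCurve : ∀ {P} → Triple x y P → OnCurve P
      onCurve neutral      = tt
      onCurve (±point p r) = IsFlex.onCurve (triple-flex f p r)
      ⊕-closed : ∀ {P Q} → Triple x y P → Triple x y Q → Triple x y (P ⊕ Q)
      ⊕-closed neutral      t       = t
      ⊕-closed (±point p r) neutral = ±point p r
      ⊕-closed {aff x₁ y₁} {aff x₂ y₂} (±point p₁ r₁) (±point p₂ r₂) = sum∈ (y₁ ≟ (- y₂))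
        where
        x₁≈x₂ = trans p₁ (sym p₂)
        sum∈ : Dec (y₁ ≈ - y₂) → Triple x y (aff x₁ y₁ ⊕ aff x₂ y₂)
        sum∈ (yes e) = ≡.subst (Triple x y) (≡.sym (⊕-opposite x₁≈x₂ e)) neutral
        sum∈ (no ¬e) = ≡.subst (Triple x y) (≡.sym (⊕-tangent x₁≈x₂ ¬e))
          (respects (Setoid.sym pointSetoid (flex⇒lineSum (triple-flex f p₁ r₁) x₁≈x₂))
                    (±point p₁ (sign-flip r₁)))

    -- `to` depends on the membership proof, so `to-cong` must exclude one point carrying both
    -- signs; this is where `y≉-y` enters.
    triple-cardinality : ∀ {x y} → ¬ y ≈ 0# → HasCardinality (subsetSetoid (Triple x y)) 3
    triple-cardinality {x} {y} y≉0 = record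
      { to        = to
      ; from      = from
      ; to-cong   = λ {s} {t} → to-cong s t
      ; from-cong = λ { {i} ≡.refl → S.refl {from i} }
      ; inverse   = (λ {i} {s} e → ≡.trans (to-cong s (from i) e) (to∘from i))
                  , (λ { {s} ≡.refl → from∘to s })
      }
      where
      module S = Setoid (subsetSetoid (Triple x y))
      to : S.Carrier → Fin 3
      to (_ , neutral)           = 0F
      to (_ , ±point _ (inj₁ _)) = 1F
      to (_ , ±point _ (inj₂ _)) = 2F
      from : Fin 3 → S.Carrier
      from 0F = _ , neutral
      from 1F = aff x y , ±point refl (inj₁ refl)
      from 2F = aff x (- y) , ±point refl (inj₂ refl)
      to-cong : ∀ s t → s S.≈ t → to s ≡ to t
      to-cong (_ , neutral)           (_ , neutral)            _          = ≡.refl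
      to-cong (_ , ±point _ (inj₁ r)) (_ , ±point _ (inj₁ r′)) _          = ≡.refl
      to-cong (_ , ±point _ (inj₂ r)) (_ , ±point _ (inj₂ r′)) _          = ≡.refl
      to-cong (_ , ±point _ (inj₁ r)) (_ , ±point _ (inj₂ r′)) (aff≈ _ e) =
        contradiction (trans (sym r) (trans e r′)) (y≉-y y≉0)
      to-cong (_ , ±point _ (inj₂ r)) (_ , ±point _ (inj₁ r′)) (aff≈ _ e) =
        contradiction (trans (sym r′) (trans (sym e) r)) (y≉-y y≉0)
      to∘from : ∀ i → to (from i) ≡ i
      to∘from 0F = ≡.refl
      to∘from 1F = ≡.refl
      to∘from 2F = ≡.refl
      from∘to : ∀ s → from (to s) S.≈ s
      from∘to (_ , neutral)           = 𝒪≈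
      from∘to (_ , ±point p (inj₁ r)) = aff≈ (sym p) (sym r)
      from∘to (_ , ±point p (inj₂ r)) = aff≈ (sym p) (sym r)

    -- (- x₁ - x₂ , 0) is the sum of the 2-torsion points (x₁ , 0) and (x₂ , 0).
    double-root⇒singular : ∀ {x₁ x₂} → ¬ x₁ ≈ x₂ →
      x₁ ^ 3 + A * x₁ + B ≈ 0# → x₂ ^ 3 + A * x₂ + B ≈ 0# →
      - x₁ - x₂ ≈ x₁ → 4 · A ^ 3 + 27 · B ^ 2 ≈ 0#
    double-root⇒singular {x₁} {x₂} x₁≉x₂ root₁ root₂ double = begin
      4 · A ^ 3 + 27 · B ^ 2
        ≈⟨ +-cong (·-congʳ 4 (^-congˡ 3 A≈)) (·-congʳ 27 (^-congˡ 2 B≈)) ⟩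
      4 · (- (3 · x₁ ^ 2)) ^ 3 + 27 · (2 · x₁ ^ 3) ^ 2
        ≈⟨ solveᵣ 1 (λ x → 4 :× (:- (3 :× x :^ 2)) :^ 3 :+ 27 :× (2 :× x :^ 3) :^ 2 := :0) refl x₁ ⟩
      0# ∎
      where
      -- The roots of the cubic sum to 0, so it is (X - x₁)²(X + 2x₁), which gives A = - 3x₁² and B
      -- = 2x₁³.
      x₂≈ : x₂ ≈ - (2 · x₁)
      x₂≈ = begin
        x₂                                           ≈⟨ solveᵣ 2 (λ x₁ x₂ → x₂ := :- (2 :× x₁) :+ (:- :1) :* (:- x₁ :- x₂ :- x₁)) refl x₁ x₂ ⟩
        - (2 · x₁) + (- 1#) * (- x₁ - x₂ - x₁)       ≈⟨ modulo double _ _ ⟩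
        - (2 · x₁)                                   ∎
      -- The difference of the two root equations, divided by x₁ - x₂.
      quotient : x₁ ^ 2 + x₁ * x₂ + x₂ ^ 2 + A ≈ 0#
      quotient = *-cancelˡ (x₁≉x₂ ∘ x-y≈0⇒x≈y x₁ x₂) (begin
        (x₁ - x₂) * (x₁ ^ 2 + x₁ * x₂ + x₂ ^ 2 + A)
          ≈⟨ solveᵣ 4 (λ x₁ x₂ A B → (x₁ :- x₂) :* (x₁ :^ 2 :+ x₁ :* x₂ :+ x₂ :^ 2 :+ A)
               := (x₁ :- x₂) :* :0 :+ :1 :* ((x₁ :^ 3 :+ A :* x₁ :+ B) :- (x₂ :^ 3 :+ A :* x₂ :+ B))) refl x₁ x₂ A B ⟩
        (x₁ - x₂) * 0# + 1# * ((x₁ ^ 3 + A * x₁ + B) - (x₂ ^ 3 + A * x₂ + B))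
          ≈⟨ modulo (trans root₁ (sym root₂)) _ _ ⟩
        (x₁ - x₂) * 0# ∎)
      A≈ : A ≈ - (3 · x₁ ^ 2)
      A≈ = begin
        A ≈⟨ solveᵣ 2 (λ x A → A := :- (3 :× x :^ 2) :+ :1 :* (x :^ 2 :+ x :* (:- (2 :× x)) :+ (:- (2 :× x)) :^ 2 :+ A :- :0)) refl x₁ A ⟩
        - (3 · x₁ ^ 2) + 1# * (x₁ ^ 2 + x₁ * (- (2 · x₁)) + (- (2 · x₁)) ^ 2 + A - 0#)
          ≈⟨ modulo (trans (+-congʳ (+-cong (+-congˡ (*-congˡ (sym x₂≈))) (^-congˡ 2 (sym x₂≈)))) quotient) _ _ ⟩
        - (3 · x₁ ^ 2) ∎
      B≈ : B ≈ 2 · x₁ ^ 3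
      B≈ = begin
        B ≈⟨ solveᵣ 2 (λ x B → B := 2 :× x :^ 3 :+ :1 :* (x :^ 3 :+ (:- (3 :× x :^ 2)) :* x :+ B :- :0)) refl x₁ B ⟩
        2 · x₁ ^ 3 + 1# * (x₁ ^ 3 + (- (3 · x₁ ^ 2)) * x₁ + B - 0#)
          ≈⟨ modulo (trans (+-congʳ (+-congˡ (*-congʳ (sym A≈)))) root₁) _ _ ⟩
        2 · x₁ ^ 3 ∎

    -- Extracting a flex from a subgroup with three elements.

    module _ {p} {G : Pred (Point K) p} (isSubgroup : IsSubgroup G) where
      open IsSubgroup isSubgroup

      Exhaust : Point K → Point K → Set _
      Exhaust P Q = ∀ {R} → G R → R ≈ₚ 𝒪 ⊎ R ≈ₚ P ⊎ R ≈ₚ Q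

      -- The last component, uniqueness of the abscissa in `G`, is what later makes x fixed by
      -- Frobenius.
      FlexPoint : Set _
      FlexPoint = Σ[ x ∈ Carrier ] Σ[ y ∈ Carrier ]
        G (aff x y) × IsFlex A B x y × (∀ {x′ y′} → G (aff x′ y′) → x′ ≈ x)

      exhaust-x : ∀ {x₁ y₁ x₂ y₂} → Exhaust (aff x₁ y₁) (aff x₂ y₂) →
                  ∀ {x y} → G (aff x y) → x ≈ x₁ ⊎ x ≈ x₂
      exhaust-x exhaust g with exhaust g
      ... | inj₂ (inj₁ (aff≈ e _)) = inj₁ e
      ... | inj₂ (inj₂ (aff≈ e _)) = inj₂ e

      three-elements : HasCardinality (subsetSetoid G) 3 →
        Σ[ P ∈ Point K ] Σ[ Q ∈ Point K ] G P × G Q ×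
          ¬ P ≈ₚ 𝒪 × ¬ Q ≈ₚ 𝒪 × ¬ P ≈ₚ Q × Exhaust P Q
      three-elements card =
        proj₁ (other 0F) , proj₁ (other 1F) , proj₂ (other 0F) , proj₂ (other 1F) ,
        other≉𝒪 0F , other≉𝒪 1F ,
        (λ e → contradiction (Finₚ.punchIn-injective k 0F 1F (from-injective {punchIn k 0F} {punchIn k 1F} e)) λ ()) ,
        λ {R} g → cases R g (to (R , g) Finₚ.≟ k)
        where
        open Inverse card
        -- The given bijection may place 𝒪 at any index; `punchIn k` enumerates the other two.
        k = to (𝒪 , 𝒪∈)
        other : Fin 2 → Σ (Point K) G
        other j = from (punchIn k j)
        from-injective : ∀ {i j} → proj₁ (from i) ≈ₚ proj₁ (from j) → i ≡ j
        from-injective {i} {j} e =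
          ≡.trans (≡.sym (strictlyInverseˡ i)) (≡.trans (to-cong e) (strictlyInverseˡ j))
        other≉𝒪 : ∀ j → ¬ proj₁ (other j) ≈ₚ 𝒪
        other≉𝒪 j e = Finₚ.punchInᵢ≢i k j
          (≡.trans (≡.sym (strictlyInverseˡ _)) (to-cong {other j} {𝒪 , 𝒪∈} e))
        from-index : ∀ R g {i} → to (R , g) ≡ i → R ≈ₚ proj₁ (from i)
        from-index R g ≡.refl = Setoid.sym pointSetoid (strictlyInverseʳ (R , g))
        cases : ∀ R g → Dec (to (R , g) ≡ k) → R ≈ₚ 𝒪 ⊎ R ≈ₚ proj₁ (other 0F) ⊎ R ≈ₚ proj₁ (other 1F)
        cases R g (yes i≡k) = inj₁ (Setoid.trans pointSetoid (from-index R g i≡k) (strictlyInverseʳ (𝒪 , 𝒪∈)))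
        cases R g (no i≢k)  = inj₂ (nonzero (punchOut (i≢k ∘ ≡.sym)) (≡.sym (Finₚ.punchIn-punchOut (i≢k ∘ ≡.sym))))
          where
          nonzero : ∀ j → to (R , g) ≡ punchIn k j → R ≈ₚ proj₁ (other 0F) ⊎ R ≈ₚ proj₁ (other 1F)
          nonzero 0F e = inj₁ (from-index R g e)
          nonzero 1F e = inj₂ (from-index R g e)

      -- The negative of P lies in `G` and differs from P and 𝒪, so it is Q, and only one abscissa
      -- occurs in `G`. The double of P is affine and in `G`, hence has that abscissa too, which is
      -- the tangent condition.
      y≉0⇒flexPoint : ∀ {x₁ y₁ x₂ y₂} → G (aff x₁ y₁) → Exhaust (aff x₁ y₁) (aff x₂ y₂) →
                      ¬ y₁ ≈ 0# → FlexPoint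
      y≉0⇒flexPoint {x₁} {y₁} {x₂} {y₂} g exhaust y₁≉0 =
        x₁ , y₁ , g ,
        tangent-x⇒flex (onCurve g) y₁≉0 (x≈x₁ (≡.subst G (⊕-tangent refl (y≉-y y₁≉0)) (⊕-closed g g))) ,
        x≈x₁
        where
        x₂≈x₁ : x₂ ≈ x₁
        x₂≈x₁ with exhaust (neg-closed g)
        ... | inj₂ (inj₁ (aff≈ _ e)) = contradiction (sym e) (y≉-y y₁≉0)
        ... | inj₂ (inj₂ (aff≈ e _)) = sym e
        x≈x₁ : ∀ {x′ y′} → G (aff x′ y′) → x′ ≈ x₁
        x≈x₁ g′ = [ (λ e → e) , (λ e → trans e x₂≈x₁) ]′ (exhaust-x exhaust g′)

      y≈0⇒root : ∀ {x y} → G (aff x y) → y ≈ 0# → x ^ 3 + A * x + B ≈ 0#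
      y≈0⇒root {x} {y} g y≈0 = begin
        x ^ 3 + A * x + B   ≈⟨ sym (onCurve g) ⟩
        y ^ 2               ≈⟨ ^-congˡ 2 y≈0 ⟩
        0# ^ 2              ≈⟨ solveᵣ 0 (:0 :^ 2 := :0) refl ⟩
        0#                  ∎

      -- The chord through P and Q is the line y = 0, so their sum has abscissa - x₁ - x₂, the third
      -- root of the cubic. Closure makes this x₁ or x₂, a double root.
      two-torsion⇒singular : ∀ {x₁ y₁ x₂ y₂} → G (aff x₁ y₁) → G (aff x₂ y₂) →
        ¬ aff x₁ y₁ ≈ₚ aff x₂ y₂ → Exhaust (aff x₁ y₁) (aff x₂ y₂) →
        y₁ ≈ 0# → y₂ ≈ 0# → 4 · A ^ 3 + 27 · B ^ 2 ≈ 0#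
      two-torsion⇒singular {x₁} {y₁} {x₂} {y₂} g₁ g₂ P≉Q exhaust y₁≈0 y₂≈0 =
        [ double-root⇒singular x₁≉x₂ root₁ root₂ ∘ trans (sym x₃≈)
        , double-root⇒singular (x₁≉x₂ ∘ sym) root₂ root₁ ∘ trans (trans (+-comm _ _) (sym x₃≈))
        ]′ (exhaust-x exhaust (≡.subst G (⊕-chord x₁≉x₂) (⊕-closed g₁ g₂)))
        where
        x₁≉x₂ : ¬ x₁ ≈ x₂
        x₁≉x₂ e = P≉Q (aff≈ e (trans y₁≈0 (sym y₂≈0)))
        root₁ = y≈0⇒root g₁ y₁≈0
        root₂ = y≈0⇒root g₂ y₂≈0
        i = (x₂ - x₁) ⁻¹
        x₃≈ : ((y₂ - y₁) * i) ^ 2 - x₁ - x₂ ≈ - x₁ - x₂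
        x₃≈ = begin
          ((y₂ - y₁) * i) ^ 2 - x₁ - x₂   ≈⟨ +-congʳ (+-congʳ (^-congˡ 2 (*-congʳ (+-cong y₂≈0 (-‿cong y₁≈0))))) ⟩
          ((0# - 0#) * i) ^ 2 - x₁ - x₂   ≈⟨ solveᵣ 3 (λ i x₁ x₂ → ((:0 :- :0) :* i) :^ 2 :- x₁ :- x₂ := :- x₁ :- x₂) refl i x₁ x₂ ⟩
          - x₁ - x₂                       ∎

      order3⇒flexPoint : ¬ 4 · A ^ 3 + 27 · B ^ 2 ≈ 0# →
                         HasCardinality (subsetSetoid G) 3 → FlexPoint
      order3⇒flexPoint nonsingular card = go (three-elements card)
        where
        go : _ → FlexPoint
        go (𝒪 , _ , _ , _ , P≉𝒪 , _) = contradiction 𝒪≈ P≉𝒪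
        go (aff _ _ , 𝒪 , _ , _ , _ , Q≉𝒪 , _) = contradiction 𝒪≈ Q≉𝒪
        go (aff x₁ y₁ , aff x₂ y₂ , g₁ , g₂ , _ , _ , P≉Q , exhaust) = cases (y₁ ≟ 0#) (y₂ ≟ 0#)
          where
          swap : Exhaust (aff x₂ y₂) (aff x₁ y₁)
          swap g = map₂ swap-⊎ (exhaust g)
          cases : Dec (y₁ ≈ 0#) → Dec (y₂ ≈ 0#) → FlexPoint
          cases (no y₁≉0)  _          = y≉0⇒flexPoint g₁ exhaust y₁≉0
          cases (yes _)    (no y₂≉0)  = y≉0⇒flexPoint g₂ swap y₂≉0
          cases (yes y₁≈0) (yes y₂≈0) =
            contradiction (two-torsion⇒singular g₁ g₂ P≉Q exhaust y₁≈0 y₂≈0) nonsingular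

-- Change of variables in sums over a finite setoid.

module Reindexing {a ℓ m ℓm} {S : Setoid a ℓ} {n : ℕ} (card : HasCardinality S n) (M : CommutativeMonoid m ℓm) where
  private module M = CommutativeMonoid M
  open Setoid S
  open Inverse card
  open Sum M using (sum; sum-permute; sum-cong-≋)

  -- `φ` is transported to a permutation of the indices. It is applied to translation by 1 in the
  -- additive monoid and to multiplication by a nonzero element in the multiplicative one.
  sum-reindex : ∀ {f : Carrier → M.Carrier} → (∀ {x y} → x ≈ y → f x M.≈ f y) →
    ∀ {φ ψ : Carrier → Carrier} → (∀ {x y} → x ≈ y → φ x ≈ φ y) → (∀ {x y} → x ≈ y → ψ x ≈ ψ y) →
    (∀ x → φ (ψ x) ≈ x) → (∀ x → ψ (φ x) ≈ x) →
    sum (f ∘ from) M.≈ sum (f ∘ φ ∘ from)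
  sum-reindex {f} f-cong {φ} {ψ} φ-cong ψ-cong φψ ψφ =
    M.trans (sum-permute (f ∘ from) π) (sum-cong-≋ (λ i → f-cong (strictlyInverseʳ (φ (from i)))))
    where
    round-trip : ∀ {g h : Carrier → Carrier} → (∀ {x y} → x ≈ y → g x ≈ g y) → (∀ x → g (h x) ≈ x) →
                 ∀ i → to (g (from (to (h (from i))))) ≡ i
    round-trip g-cong gh i =
      ≡.trans (to-cong (trans (g-cong (strictlyInverseʳ _)) (gh (from i)))) (strictlyInverseˡ i)
    π : Permutation n n
    π = permutation (to ∘ φ ∘ from) (to ∘ ψ ∘ from) (round-trip φ-cong φψ) (round-trip ψ-cong ψφ)

-- Characteristic and Fermat's little theorem in a field with q elements.

module FiniteField {c ℓ} (F : Field c ℓ) (q : ℕ) (card : HasCardinality (Field.setoid F) q) where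
  open Field F hiding (zero)
  open FieldProperties F
  open DifferenceSolver commutativeRing
  open SetoidReasoning setoid
  open Inverse card using (to; from; to-cong; strictlyInverseˡ; strictlyInverseʳ)

  -- Translation by 1 permutes the field, so the sum S of all elements satisfies S = q · 1 + S.
  q·1≈0 : q · 1# ≈ 0#
  q·1≈0 = begin
    q · 1#                 ≈⟨ solveᵣ 2 (λ S Q → Q := Q :+ S :- S) refl (sum from) (q · 1#) ⟩
    q · 1# + sum from - sum from
      ≈⟨ +-congʳ (+-cong (sym (sum-replicate q)) refl) ⟩
    sum {q} (λ _ → 1#) + sum from - sum from
      ≈⟨ +-congʳ (sym (∑-distrib-+ (λ _ → 1#) from)) ⟩
    sum (λ i → 1# + from i) - sum from
      ≈⟨ +-congʳ (sym (sum-reindex id +-congˡ +-congˡ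
           (λ x → solveᵣ 1 (λ x → :1 :+ (:- :1 :+ x) := x) refl x)
           (λ x → solveᵣ 1 (λ x → :- :1 :+ (:1 :+ x) := x) refl x))) ⟩
    sum from - sum from    ≈⟨ -‿inverseʳ _ ⟩
    0#                     ∎
    where
    open Sum +-commutativeMonoid
    open Reindexing card +-commutativeMonoid

  -- Writing q = 1 + (q / n) n, vanishing of n · 1 would give q · 1 = 1, whereas q · 1 = 0.
  q%n≡1⇒n·1≉0 : ∀ n .{{_ : ℕ.NonZero n}} → q % n ≡ 1 → ¬ n · 1# ≈ 0#
  q%n≡1⇒n·1≉0 n q%n≡1 n≈0 = 1≉0 (begin
    1#                                       ≈⟨ sym (+-identityʳ 1#) ⟩
    1 · 1#                                   ≈⟨ sym (+-identityʳ _) ⟩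
    1 · 1# + 0#                              ≈⟨ +-congˡ (sym (zeroʳ _)) ⟩
    1 · 1# + (q / n) · 1# * 0#               ≈⟨ +-congˡ (*-congˡ (sym n≈0)) ⟩
    1 · 1# + (q / n) · 1# * n · 1#           ≈⟨ +-congˡ (sym (×1-homo-* (q / n) n)) ⟩
    1 · 1# + ((q / n) ℕ.* n) · 1#            ≈⟨ sym (×-homo-+ 1# 1 ((q / n) ℕ.* n)) ⟩
    (1 ℕ.+ (q / n) ℕ.* n) · 1#               ≈⟨ reflexive (≡.cong (_· 1#) (≡.cong (ℕ._+ (q / n) ℕ.* n) (≡.sym q%n≡1))) ⟩
    (q % n ℕ.+ (q / n) ℕ.* n) · 1#           ≈⟨ reflexive (≡.cong (_· 1#) (≡.sym (DivMod.m≡m%n+[m/n]*n q n))) ⟩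
    q · 1#                                   ≈⟨ q·1≈0 ⟩
    0#                                       ∎)

  private
    module Π = Sum *-commutativeMonoid

    product-nonzero : ∀ {n} (f : Fin n → Carrier) → (∀ i → ¬ f i ≈ 0#) → ¬ Π.sum f ≈ 0#
    product-nonzero {zero}  f f≉0 = 1≉0
    product-nonzero {suc n} f f≉0 = *-nonzero (f≉0 zero) (product-nonzero (f ∘ suc) (f≉0 ∘ suc))

    -- Replacing zero by 1 lets nonzero products range over all of F.
    ifZero : ∀ {x} → Dec (x ≈ 0#) → Carrier → Carrier
    ifZero (yes _) y = 1#
    ifZero (no _)  y = y

    ifZero-yes : ∀ {x} (d : Dec (x ≈ 0#)) y → x ≈ 0# → ifZero d y ≈ 1#
    ifZero-yes (yes _)  y _   = refl
    ifZero-yes (no x≉0) y x≈0 = contradiction x≈0 x≉0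

    ifZero-no : ∀ {x} (d : Dec (x ≈ 0#)) y → ¬ x ≈ 0# → ifZero d y ≈ y
    ifZero-no (yes x≈0) y x≉0 = contradiction x≈0 x≉0
    ifZero-no (no _)    y _   = refl

    unit : Carrier → Carrier
    unit x = ifZero (x ≟ 0#) x

    unit-cong : ∀ {x y} → x ≈ y → unit x ≈ unit y
    unit-cong {x} {y} x≈y = go (x ≟ 0#)
      where
      go : Dec (x ≈ 0#) → unit x ≈ unit y
      go (yes x≈0) = trans (ifZero-yes (x ≟ 0#) x x≈0) (sym (ifZero-yes (y ≟ 0#) y (trans (sym x≈y) x≈0)))
      go (no x≉0)  = trans (ifZero-no (x ≟ 0#) x x≉0)
                       (trans x≈y (sym (ifZero-no (y ≟ 0#) y (x≉0 ∘ trans x≈y))))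

    unit-nonzero : ∀ x → ¬ unit x ≈ 0#
    unit-nonzero x with x ≟ 0#
    ... | yes _  = 1≉0
    ... | no x≉0 = x≉0

    unit-* : ∀ {a} x → ¬ a ≈ 0# → unit (a * x) ≈ ifZero (x ≟ 0#) a * unit x
    unit-* {a} x a≉0 with x ≟ 0#
    ... | yes x≈0 = trans (ifZero-yes ((a * x) ≟ 0#) _ (trans (*-congˡ x≈0) (zeroʳ a))) (sym (*-identityˡ 1#))
    ... | no x≉0  = ifZero-no ((a * x) ≟ 0#) _ (*-nonzero a≉0 x≉0)

    -- Multiplication by a permutes the field and fixes 0, so it preserves the product of the
    -- nonzero elements while multiplying each factor by a; that product then cancels.
    scalar-product≈1 : ∀ {a} → ¬ a ≈ 0# → Π.sum (λ i → ifZero (from i ≟ 0#) a) ≈ 1#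
    scalar-product≈1 {a} a≉0 = *-cancelˡ (product-nonzero (unit ∘ from) (unit-nonzero ∘ from)) (begin
      Π.sum (unit ∘ from) * Π.sum h    ≈⟨ *-comm _ _ ⟩
      Π.sum h * Π.sum (unit ∘ from)    ≈⟨ sym (Π.∑-distrib-+ h (unit ∘ from)) ⟩
      Π.sum (λ i → h i * unit (from i))
        ≈⟨ Π.sum-cong-≋ (λ i → sym (unit-* (from i) a≉0)) ⟩
      Π.sum (λ i → unit (a * from i))
        ≈⟨ sym (sum-reindex unit-cong *-congˡ *-congˡ
             (λ x → trans (sym (*-assoc a (a ⁻¹) x)) (trans (*-congʳ (inverseʳ a≉0)) (*-identityˡ x)))
             (λ x → trans (sym (*-assoc (a ⁻¹) a x)) (trans (*-congʳ (trans (*-comm _ _) (inverseʳ a≉0))) (*-identityˡ x)))) ⟩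
      Π.sum (unit ∘ from)              ≈⟨ sym (*-identityʳ _) ⟩
      Π.sum (unit ∘ from) * 1#         ∎)
      where
      open Reindexing card *-commutativeMonoid
      h : Fin q → Carrier
      h i = ifZero (from i ≟ 0#) a

    -- The factor at `k` is 1, leaving n - 1 copies of a. The extra a in front turns this into a ^ n
    -- without a predecessor of n.
    scalar-product : ∀ {n} (f : Fin n → Carrier) (k : Fin n) → f k ≈ 0# →
      (∀ i → f i ≈ 0# → i ≡ k) → ∀ a → a * Π.sum (λ i → ifZero (f i ≟ 0#) a) ≈ a ^ n
    scalar-product {suc n} f k fk≈0 unique a = *-congˡ (begin
      Π.sum h                               ≈⟨ Π.sum-remove {i = k} h ⟩
      h k * Π.sum (λ j → h (punchIn k j))   ≈⟨ *-cong (ifZero-yes (f k ≟ 0#) a fk≈0) (Π.sum-cong-≋ h≈a) ⟩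
      1# * Π.sum {n} (λ _ → a)              ≈⟨ *-identityˡ _ ⟩
      Π.sum {n} (λ _ → a)                   ≈⟨ Π.sum-replicate n ⟩
      a ^ n                                 ∎)
      where
      h : Fin (suc n) → Carrier
      h i = ifZero (f i ≟ 0#) a
      h≈a : ∀ j → h (punchIn k j) ≈ a
      h≈a j = ifZero-no (f (punchIn k j) ≟ 0#) a (Finₚ.punchInᵢ≢i k j ∘ unique _)

  fermat : ∀ x → x ^ q ≈ x
  fermat x = go (x ≟ 0#)
    where
    -- The power 0 ^ 0 is 1, so an index in `Fin n` is required as evidence that n is positive.
    zero-power : ∀ {n} → Fin n → 0# ^ n ≈ 0#
    zero-power {suc n} _ = zeroˡ _
    go : Dec (x ≈ 0#) → x ^ q ≈ x
    go (yes x≈0) = trans (^-congˡ q x≈0) (trans (zero-power (to 0#)) (sym x≈0))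
    go (no x≉0)  = begin
      x ^ q    ≈⟨ sym (scalar-product from (to 0#) (strictlyInverseʳ 0#)
                    (λ i e → ≡.trans (≡.sym (strictlyInverseˡ i)) (to-cong e)) x) ⟩
      x * Π.sum (λ i → ifZero (from i ≟ 0#) x)   ≈⟨ *-congˡ (scalar-product≈1 x≉0) ⟩
      x * 1#   ≈⟨ *-identityʳ x ⟩
      x        ∎

-- A monic polynomial of degree n has at most n roots.

module RootCounting {c ℓ} (K : Field c ℓ) where
  open Field K hiding (zero)
  open FieldProperties K
  open DifferenceSolver commutativeRing
  open SetoidReasoning setoid

  -- The monic polynomial of degree n with the given lower coefficients,
  -- constant term first.
  horner : ∀ {n} → Vec Carrier n → Carrier → Carrier
  horner []       x = 1#
  horner (c ∷ cs) x = c + x * horner cs x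

  -- Synthetic division by X - a: each coefficient is the value at a of a tail of the polynomial.
  quotient : ∀ {n} → Carrier → Vec Carrier (suc n) → Vec Carrier n
  quotient a (c ∷ [])         = []
  quotient a (c ∷ cs@(_ ∷ _)) = horner cs a ∷ quotient a cs

  division : ∀ {n} a (cs : Vec Carrier (suc n)) x →
             horner cs x ≈ horner cs a + (x - a) * horner (quotient a cs) x
  division a (c ∷ [])         x = solveᵣ 3 (λ c x a → c :+ x :* :1 := c :+ a :* :1 :+ (x :- a) :* :1) refl c x a
  division a (c ∷ cs@(_ ∷ _)) x = begin
    c + x * horner cs x
      ≈⟨ +-congˡ (*-congˡ (division a cs x)) ⟩
    c + x * (horner cs a + (x - a) * horner (quotient a cs) x)
      ≈⟨ solveᵣ 5 (λ c x a h r → c :+ x :* (h :+ (x :- a) :* r) := c :+ a :* h :+ (x :- a) :* (h :+ x :* r))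
           refl c x a (horner cs a) (horner (quotient a cs) x) ⟩
    c + a * horner cs a + (x - a) * (horner cs a + x * horner (quotient a cs) x) ∎

  -- Induction on the degree: divide out X - `r zero`; the other points, being different from it,
  -- are roots of the quotient.
  too-many-roots : ∀ {n} (cs : Vec Carrier n) (r : Fin (suc n) → Carrier) →
    (∀ {i j} → r i ≈ r j → i ≡ j) → ¬ (∀ i → horner cs (r i) ≈ 0#)
  too-many-roots []          r r-inj root = 1≉0 (root zero)
  too-many-roots cs@(_ ∷ _) r r-inj root =
    too-many-roots (quotient a cs) (r ∘ suc) (Finₚ.suc-injective ∘ r-inj) λ i →
      [ (λ e → contradiction (r-inj {suc i} {zero} (x-y≈0⇒x≈y _ _ e)) λ ()) , id ]′
      (zero-product (begin
        (r (suc i) - a) * horner (quotient a cs) (r (suc i))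
          ≈⟨ sym (+-identityˡ _) ⟩
        0# + (r (suc i) - a) * horner (quotient a cs) (r (suc i))
          ≈⟨ +-congʳ (sym (root zero)) ⟩
        horner cs a + (r (suc i) - a) * horner (quotient a cs) (r (suc i))
          ≈⟨ sym (division a cs (r (suc i))) ⟩
        horner cs (r (suc i))
          ≈⟨ root (suc i) ⟩
        0# ∎))
    where a = r zero

  -- The lower coefficients of X^(m+2) - X. The shift by 2 keeps the polynomial monic of the degree
  -- shown, which fails for exponents 0 and 1.
  powerCoefficients : ∀ m → Vec Carrier (suc (suc m))
  powerCoefficients m = 0# ∷ - 1# ∷ replicate m 0#

  horner-zeros : ∀ m x → horner (replicate m 0#) x ≈ x ^ m
  horner-zeros zero    x = refl
  horner-zeros (suc m) x = trans (+-identityˡ _) (*-congˡ (horner-zeros m x))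

  horner-power : ∀ m x → horner (powerCoefficients m) x ≈ x ^ suc (suc m) - x
  horner-power m x = begin
    0# + x * (- 1# + x * horner (replicate m 0#) x)  ≈⟨ +-congˡ (*-congˡ (+-congˡ (*-congˡ (horner-zeros m x)))) ⟩
    0# + x * (- 1# + x * x ^ m)                      ≈⟨ solveᵣ 2 (λ x p → :0 :+ x :* (:- :1 :+ x :* p) := x :* (x :* p) :- x) refl x (x ^ m) ⟩
    x * (x * x ^ m) - x                              ∎

  power-fixed-points : ∀ m (r : Fin (suc m) → Carrier) →
    (∀ {i j} → r i ≈ r j → i ≡ j) → 2 ℕ.≤ m → ¬ (∀ i → r i ^ m ≈ r i)
  power-fixed-points (suc (suc m)) r r-inj _ fixed =
    too-many-roots (powerCoefficients m) r r-inj λ i →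
      trans (horner-power m (r i)) (x≈y⇒x-y≈0 (fixed i))
  power-fixed-points (suc zero) _ _ (s≤s ()) _

-- Isomorphisms and twists when 2 and 3 are invertible.

module Scaling {c ℓ} (F : Field c ℓ) (2≉0 : ¬ Field._≈_ F (Field._·_ F 2 (Field.1# F)) (Field.0# F))
  (3≉0 : ¬ Field._≈_ F (Field._·_ F 3 (Field.1# F)) (Field.0# F)) where
  open Field F
  open FieldProperties F
  open DifferenceSolver commutativeRing
  open SetoidReasoning setoid
  open Curves F

  record _≅ᵤ_ (E E′ : EllipticCurve F) : Set (c ⊔ ℓ) where
    private
      module E  = EllipticCurve E
      module E′ = EllipticCurve E′
    field
      u     : Carrier
      u≉0   : ¬ u ≈ 0#
      A-eq  : u ^ 4 * E′.A ≈ E.A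
      B-eq  : u ^ 6 * E′.B ≈ E.B

  -- From 2s = 0 and 2t = 0 follow s = t = 0, and then 3r = s² = 0 gives r = 0, so only the scaling
  -- by u survives.
  ≅⇒≅ᵤ : ∀ {E E′} → _≅_ F E E′ → E ≅ᵤ E′
  ≅⇒≅ᵤ {E} {E′} i = record
    { u    = u
    ; u≉0  = u≉0
    ; A-eq = begin
        u ^ 4 * E′.A                   ≈⟨ solveᵣ 1 (λ a → a := a :+ 2 :× (:0 :* :0)) refl (u ^ 4 * E′.A) ⟩
        u ^ 4 * E′.A + 2 · (0# * 0#)   ≈⟨ +-congˡ (·-congʳ 2 (*-cong (sym s≈0) (sym t≈0))) ⟩
        u ^ 4 * E′.A + 2 · (s * t)     ≈⟨ x-coeff ⟩
        E.A + 3 · r ^ 2                ≈⟨ +-congˡ (·-congʳ 3 (^-congˡ 2 r≈0)) ⟩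
        E.A + 3 · 0# ^ 2               ≈⟨ solveᵣ 1 (λ a → a :+ 3 :× :0 :^ 2 := a) refl E.A ⟩
        E.A                            ∎
    ; B-eq = begin
        u ^ 6 * E′.B                   ≈⟨ solveᵣ 1 (λ b → b := b :+ :0 :^ 2) refl (u ^ 6 * E′.B) ⟩
        u ^ 6 * E′.B + 0# ^ 2          ≈⟨ +-congˡ (^-congˡ 2 (sym t≈0)) ⟩
        u ^ 6 * E′.B + t ^ 2           ≈⟨ 1-coeff ⟩
        E.B + r * E.A + r ^ 3          ≈⟨ +-cong (+-congˡ (*-congʳ r≈0)) (^-congˡ 3 r≈0) ⟩
        E.B + 0# * E.A + 0# ^ 3        ≈⟨ solveᵣ 2 (λ a b → b :+ :0 :* a :+ :0 :^ 3 := b) refl E.A E.B ⟩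
        E.B                            ∎
    }
    where
    module E  = EllipticCurve E
    module E′ = EllipticCurve E′
    open _≅_ i
    s≈0 = ·-zero 2 2≉0 xy-coeff
    t≈0 = ·-zero 2 2≉0 y-coeff
    r≈0 = ·-zero 3 3≉0 (trans x²-coeff (trans (^-congˡ 2 s≈0) (solveᵣ 0 (:0 :^ 2 := :0) refl)))

  ≅ᵤ⇒≅ : ∀ {E E′} → E ≅ᵤ E′ → _≅_ F E E′
  ≅ᵤ⇒≅ {E} {E′} i = record
    { u = u ; r = 0# ; s = 0# ; t = 0#
    ; u≉0      = u≉0
    ; xy-coeff = solveᵣ 0 (2 :× :0 := :0) refl
    ; x²-coeff = solveᵣ 0 (3 :× :0 := :0 :^ 2) refl
    ; y-coeff  = solveᵣ 0 (2 :× :0 := :0) refl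
    ; x-coeff  = trans (+-congʳ A-eq) (solveᵣ 1 (λ a → a :+ 2 :× (:0 :* :0) := a :+ 3 :× :0 :^ 2) refl E.A)
    ; 1-coeff  = trans (+-congʳ B-eq) (solveᵣ 2 (λ a b → b :+ :0 :^ 2 := b :+ :0 :* a :+ :0 :^ 3) refl E.A E.B)
    }
    where
    module E = EllipticCurve E
    open _≅ᵤ_ i

  module _ (d : Carrier) (d≉0 : ¬ d ≈ 0#) where

    private
      swap : ∀ a b x → a * (b * x) ≈ b * (a * x)
      swap = solveᵣ 3 (λ a b x → a :* (b :* x) := b :* (a :* x)) refl

    twist-cong : ∀ {E E′} → _≅_ F E E′ → _≅_ F (twist d d≉0 E) (twist d d≉0 E′)
    twist-cong i = ≅ᵤ⇒≅ (record
      { u = u ; u≉0 = u≉0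
      ; A-eq = trans (swap _ _ _) (*-congˡ A-eq)
      ; B-eq = trans (swap _ _ _) (*-congˡ B-eq)
      })
      where open _≅ᵤ_ (≅⇒≅ᵤ i)

    -- The same `u` works on both sides: `d ^ 2` and `d ^ 3` commute past its powers and cancel.
    twist-injective : ∀ {E E′} → _≅_ F (twist d d≉0 E) (twist d d≉0 E′) → _≅_ F E E′
    twist-injective i = ≅ᵤ⇒≅ (record
      { u = u ; u≉0 = u≉0
      ; A-eq = *-cancelˡ (^-nonzero 2 d≉0) (trans (swap _ _ _) A-eq)
      ; B-eq = *-cancelˡ (^-nonzero 3 d≉0) (trans (swap _ _ _) B-eq)
      })
      where open _≅ᵤ_ (≅⇒≅ᵤ i)

    twist-involutive : ∀ E → _≅_ F (twist d d≉0 (twist d d≉0 E)) E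
    twist-involutive E = ≅ᵤ⇒≅ (record
      { u = d ; u≉0 = d≉0
      ; A-eq = solveᵣ 2 (λ d a → d :^ 4 :* a := d :^ 2 :* (d :^ 2 :* a)) refl d (EllipticCurve.A E)
      ; B-eq = solveᵣ 2 (λ d b → d :^ 6 :* b := d :^ 3 :* (d :^ 3 :* b)) refl d (EllipticCurve.B E)
      })

-- The finite field as the fixed set of Frobenius in its closure.

module Descent {c ℓ c′ ℓ′} (F : Field c ℓ) (F̄ : AlgebraicClosure F c′ ℓ′) (q : ℕ)
  (card : HasCardinality (Field.setoid F) q) where
  open AlgebraicClosure F̄ using (ι; isRingHomomorphism) renaming (closure to K)
  private
    module F = Field F
    module Fₚ = FieldProperties F
  open Field K hiding (zero)
  open FieldProperties K
  open DifferenceSolver commutativeRing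
  open SetoidReasoning setoid
  open Inverse card using (to; from; to-cong; strictlyInverseˡ; strictlyInverseʳ)
  open FiniteField F q card using (fermat)
  open CommutativeExp commutativeSemiring using (^-distrib-*)
  open RingMorphisms.IsRingHomomorphism isRingHomomorphism public
    using (+-homo; *-homo; -‿homo; 0#-homo; 1#-homo) renaming (⟦⟧-cong to ι-cong)

  ι-nonzero : ∀ {x} → ¬ x F.≈ F.0# → ¬ ι x ≈ 0#
  ι-nonzero {x} x≉0 ιx≈0 = 1≉0 (begin
    1#                   ≈⟨ sym 1#-homo ⟩
    ι F.1#               ≈⟨ ι-cong (F.sym (F.inverseʳ x≉0)) ⟩
    ι (x F.* x F.⁻¹)     ≈⟨ *-homo x (x F.⁻¹) ⟩
    ι x * ι (x F.⁻¹)     ≈⟨ *-congʳ ιx≈0 ⟩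
    0# * ι (x F.⁻¹)      ≈⟨ zeroˡ _ ⟩
    0#                   ∎)

  ι-injective : ∀ {x y} → ι x ≈ ι y → x F.≈ y
  ι-injective {x} {y} ιx≈ιy with (x F.- y) F.≟ F.0#
  ... | yes x-y≈0 = Fₚ.x-y≈0⇒x≈y x y x-y≈0
  ... | no x-y≉0  = contradiction
    (trans (+-homo x (F.- y)) (trans (+-congˡ (-‿homo y)) (x≈y⇒x-y≈0 ιx≈ιy))) (ι-nonzero x-y≉0)

  ι-^ : ∀ x n → ι (x F.^ n) ≈ ι x ^ n
  ι-^ x zero    = 1#-homo
  ι-^ x (suc n) = trans (*-homo x (x F.^ n)) (*-congˡ (ι-^ x n))

  ι-· : ∀ n x → ι (n F.· x) ≈ n · ι x
  ι-· zero    x = 0#-homo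
  ι-· (suc n) x = trans (+-homo x (n F.· x)) (+-congˡ (ι-· n x))

  ι-frobenius : ∀ x → ι x ^ q ≈ ι x
  ι-frobenius x = trans (sym (ι-^ x q)) (ι-cong (fermat x))

  InBase : Carrier → Set _
  InBase z = ∃[ w ] ι w ≈ z

  inBase-neg : ∀ {z} → InBase z → InBase (- z)
  inBase-neg (w , e) = F.- w , trans (-‿homo w) (-‿cong e)

  2≤q : 2 ℕ.≤ q
  2≤q = go q (to F.0#) (to F.1#) λ e → F.1≉0 (F.trans (F.sym (strictlyInverseʳ F.1#))
          (F.trans (F.reflexive (≡.cong from (≡.sym e))) (strictlyInverseʳ F.0#)))
    where
    go : ∀ n (i j : Fin n) → ¬ i ≡ j → 2 ℕ.≤ n
    go 1             zero zero i≢j = contradiction ≡.refl i≢j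
    go (suc (suc n)) _    _    _   = s≤s (s≤s z≤n)

  -- If z were not among the q images of elements of `F`, adjoining it would give q + 1 distinct
  -- roots of X^q - X. The search is decidable because `F` is finite.
  frobenius-fixed : ∀ {z} → z ^ q ≈ z → InBase z
  frobenius-fixed {z} z^q≈z with Finₚ.any? (λ i → ι (from i) ≟ z)
  ... | yes (i , e) = from i , e
  ... | no ∄        = contradiction fixed (RootCounting.power-fixed-points K q r r-injective 2≤q)
    where
    r : Fin (suc q) → Carrier
    r zero    = z
    r (suc i) = ι (from i)
    r-injective : ∀ {i j} → r i ≈ r j → i ≡ j
    r-injective {zero}  {zero}  e = ≡.refl
    r-injective {zero}  {suc j} e = contradiction (j , sym e) ∄
    r-injective {suc i} {zero}  e = contradiction (i , e) ∄
    r-injective {suc i} {suc j} e = ≡.cong suc (≡.trans (≡.sym (strictlyInverseˡ i))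
      (≡.trans (to-cong (ι-injective e)) (strictlyInverseˡ j)))
    fixed : ∀ i → r i ^ q ≈ r i
    fixed zero    = z^q≈z
    fixed (suc i) = ι-frobenius (from i)

  -- As z² is fixed by the q-power map, z^q is z or - z, and the first would put z in the base.
  frobenius-sqrt : ∀ {z} → InBase (z ^ 2) → ¬ InBase z → z ^ q ≈ - z
  frobenius-sqrt {z} (w , ιw≈z²) z∉ = [ (λ e → contradiction (frobenius-fixed e) z∉) , id ]′ (squares-equal (begin
    (z ^ q) ^ 2      ≈⟨ ^-assocʳ z q 2 ⟩
    z ^ (q ℕ.* 2)    ≈⟨ reflexive (≡.cong (z ^_) (ℕₚ.*-comm q 2)) ⟩
    z ^ (2 ℕ.* q)    ≈⟨ sym (^-assocʳ z 2 q) ⟩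
    (z ^ 2) ^ q      ≈⟨ ^-congˡ q (sym ιw≈z²) ⟩
    ι w ^ q          ≈⟨ ι-frobenius w ⟩
    ι w              ≈⟨ ιw≈z² ⟩
    z ^ 2            ∎))

  sqrt-product-inBase : ∀ {y z} → InBase (y ^ 2) → ¬ InBase y → InBase (z ^ 2) → ¬ InBase z →
                        InBase (y * z)
  sqrt-product-inBase {y} {z} y² y∉ z² z∉ = frobenius-fixed (begin
    (y * z) ^ q      ≈⟨ ^-distrib-* y z q ⟩
    y ^ q * z ^ q    ≈⟨ *-cong (frobenius-sqrt y² y∉) (frobenius-sqrt z² z∉) ⟩
    - y * - z        ≈⟨ solveᵣ 2 (λ y z → :- y :* :- z := y :* z) refl y z ⟩
    y * z            ∎)

-- Carrying points and subgroups of order 3 to the twist.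

module Twisting {c ℓ c′ ℓ′} (F : Field c ℓ) (F̄ : AlgebraicClosure F c′ ℓ′) (q : ℕ)
  (card : HasCardinality (Field.setoid F) q)
  (2≉0 : ¬ Field._≈_ F (Field._·_ F 2 (Field.1# F)) (Field.0# F))
  (t : Field.Carrier F) (t≉0 : ¬ Field._≈_ F t (Field.0# F)) (nonsquare : ¬ Field.IsSquare F t) where
  open AlgebraicClosure F̄ using (ι; closed) renaming (closure to K)
  private
    module F = Field F
    module Fₚ = FieldProperties F
  open Field K hiding (zero)
  open FieldProperties K
  open DifferenceSolver commutativeRing
  open SetoidReasoning setoid
  open Descent F F̄ q card
  open Curves F using (twist; HasRationalPointOfOrder)
  open Geometric F F̄

  2≉0ᴷ : ¬ 2 · 1# ≈ 0#
  2≉0ᴷ e = ι-nonzero 2≉0 (trans (ι-· 2 F.1#) (trans (·-congʳ 2 1#-homo) e))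

  private
    module F₃ = OrderThree F 2≉0
  open OrderThree K 2≉0ᴷ

  ι-cubic : ∀ A B x → ι (x F.^ 3 F.+ A F.* x F.+ B) ≈ ι x ^ 3 + ι A * ι x + ι B
  ι-cubic A B x = trans (+-homo _ B) (+-congʳ (trans (+-homo _ _) (+-cong (ι-^ x 3) (*-homo A x))))

  ι-flexˡ : ∀ A x → ι ((3 F.· x F.^ 2 F.+ A) F.^ 2) ≈ (3 · ι x ^ 2 + ι A) ^ 2
  ι-flexˡ A x = trans (ι-^ _ 2) (^-congˡ 2 (trans (+-homo _ A)
    (+-congʳ (trans (ι-· 3 _) (·-congʳ 3 (ι-^ x 2))))))

  ι-flexʳ : ∀ x y → ι (3 F.· x F.* (2 F.· y) F.^ 2) ≈ 3 · ι x * (2 · ι y) ^ 2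
  ι-flexʳ x y = trans (*-homo _ _) (*-cong (ι-· 3 x) (trans (ι-^ _ 2) (^-congˡ 2 (ι-· 2 y))))

  ι-discriminant : ∀ A B → ι (4 F.· A F.^ 3 F.+ 27 F.· B F.^ 2) ≈ 4 · ι A ^ 3 + 27 · ι B ^ 2
  ι-discriminant A B = trans (+-homo _ _) (+-cong (trans (ι-· 4 _) (·-congʳ 4 (ι-^ A 3)))
                                                  (trans (ι-· 27 _) (·-congʳ 27 (ι-^ B 2))))

  flex-ascend : ∀ {A B x y} → F₃.IsFlex A B x y → IsFlex (ι A) (ι B) (ι x) (ι y)
  flex-ascend {A} {B} {x} {y} f = record
    { onCurve = trans (sym (ι-^ y 2)) (trans (ι-cong onCurve) (ι-cubic A B x))
    ; y≉0     = ι-nonzero y≉0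
    ; flex    = trans (sym (ι-flexˡ A x)) (trans (ι-cong flex) (ι-flexʳ x y))
    }
    where open F₃.IsFlex f

  -- The conditions are polynomial over `F`, so injectivity of `ι` reflects them; `flex⇒order3` then
  -- applies over `F` itself.
  flex-descend : ∀ {A B x y} → IsFlex (ι A) (ι B) (ι x) (ι y) → F₃.IsFlex A B x y
  flex-descend {A} {B} {x} {y} f = record
    { onCurve = ι-injective (trans (ι-^ y 2) (trans onCurve (sym (ι-cubic A B x))))
    ; y≉0     = λ y≈0 → y≉0 (trans (ι-cong y≈0) 0#-homo)
    ; flex    = ι-injective (trans (ι-flexˡ A x) (trans flex (sym (ι-flexʳ x y))))
    }
    where open IsFlex f

  sqrt : ∃[ s ] s ^ 2 ≈ ι t
  -- The coefficients, constant term first, are those of X² + 0 X - t.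
  sqrt = let (s , root) = closed (- ι t ∷ 0# ∷ []) in s , (begin
    s ^ 2                                           ≈⟨ solveᵣ 2 (λ s t → s :^ 2 := t :+ :1 :* (s :^ 2 :+ (:- t :+ s :* (:0 :+ s :* :0)) :- :0)) refl s (ι t) ⟩
    ι t + 1# * (s ^ 2 + (- ι t + s * (0# + s * 0#)) - 0#)   ≈⟨ modulo root (ι t) 1# ⟩
    ι t                                             ∎)

  s : Carrier
  s = proj₁ sqrt

  s²≈ιt : s ^ 2 ≈ ι t
  s²≈ιt = proj₂ sqrt

  s≉0 : ¬ s ≈ 0#
  s≉0 s≈0 = ι-nonzero t≉0 (trans (sym s²≈ιt) (trans (^-congˡ 2 s≈0) (zeroˡ _)))

  s∉base : ¬ InBase s
  s∉base (w , ιw≈s) = nonsquare (w , ι-injective (begin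
    ι (w F.* w)   ≈⟨ *-homo w w ⟩
    ι w * ι w     ≈⟨ *-cong ιw≈s ιw≈s ⟩
    s * s         ≈⟨ *-congˡ (sym (*-identityʳ s)) ⟩
    s ^ 2         ≈⟨ s²≈ιt ⟩
    ι t           ∎))

  s⁴≈ : ∀ A → s ^ 4 * ι A ≈ ι (t F.^ 2 F.* A)
  s⁴≈ A = begin
    s ^ 4 * ι A          ≈⟨ *-congʳ (solveᵣ 1 (λ s → s :^ 4 := (s :^ 2) :^ 2) refl s) ⟩
    (s ^ 2) ^ 2 * ι A    ≈⟨ *-congʳ (trans (^-congˡ 2 s²≈ιt) (sym (ι-^ t 2))) ⟩
    ι (t F.^ 2) * ι A    ≈⟨ sym (*-homo _ A) ⟩
    ι (t F.^ 2 F.* A)    ∎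

  s⁶≈ : ∀ B → s ^ 6 * ι B ≈ ι (t F.^ 3 F.* B)
  s⁶≈ B = begin
    s ^ 6 * ι B          ≈⟨ *-congʳ (solveᵣ 1 (λ s → s :^ 6 := (s :^ 2) :^ 3) refl s) ⟩
    (s ^ 2) ^ 3 * ι B    ≈⟨ *-congʳ (trans (^-congˡ 3 s²≈ιt) (sym (ι-^ t 3))) ⟩
    ι (t F.^ 3) * ι B    ≈⟨ sym (*-homo _ B) ⟩
    ι (t F.^ 3 F.* B)    ∎

  s²ι : ∀ x → s ^ 2 * ι x ≈ ι (t F.* x)
  s²ι x = trans (*-congʳ s²≈ιt) (sym (*-homo t x))

  rational-point⇒flex : ∀ E → HasRationalPointOfOrder 3 E →
    ∃[ x ] ∃[ y ] F₃.IsFlex (EllipticCurve.A E) (EllipticCurve.B E) x y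
  rational-point⇒flex E (𝒪 , _ , _ , minimal) = contradiction (Points.𝒪≈) (minimal 1 (s≤s z≤n) (s≤s (s≤s z≤n)))
  rational-point⇒flex E (aff x y , on , order) =
    x , y , F₃.OnEquation.order3⇒flex (EllipticCurve.eqn E) on order

  -- Since s³y = (ty) s with ty a nonzero element of `F`, a preimage w would give s = w / (ty) in
  -- the base.
  s³ιy∉base : ∀ {y} → ¬ y F.≈ F.0# → ¬ InBase (s ^ 3 * ι y)
  s³ιy∉base {y} y≉0 (w , e) = s∉base (w F.* ty F.⁻¹ , *-cancelˡ (ι-nonzero ty≉0) (begin
    ι ty * ι (w F.* ty F.⁻¹)       ≈⟨ sym (*-homo ty _) ⟩
    ι (ty F.* (w F.* ty F.⁻¹))     ≈⟨ ι-cong ty-cancel ⟩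
    ι w                            ≈⟨ e ⟩
    s ^ 3 * ι y                    ≈⟨ solveᵣ 2 (λ s y → s :^ 3 :* y := s :^ 2 :* y :* s) refl s (ι y) ⟩
    s ^ 2 * ι y * s                ≈⟨ *-congʳ (s²ι y) ⟩
    ι ty * s                       ∎))
    where
    ty = t F.* y
    ty≉0 = Fₚ.*-nonzero t≉0 y≉0
    ty-cancel : ty F.* (w F.* ty F.⁻¹) F.≈ w
    ty-cancel = F.trans (F.*-congˡ (F.*-comm w _)) (F.trans (F.sym (F.*-assoc ty _ w))
      (F.trans (F.*-congʳ (F.inverseʳ ty≉0)) (F.*-identityˡ w)))

  -- X = s²x is the image of tx, and Y = s³y lies outside the base while Y² is the image of t³y².
  -- Frobenius therefore fixes X and negates Y: it acts on the triple as negation.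
  twisted-subgroup : ∀ E → HasRationalPointOfOrder 3 E →
                     RationalSubgroupWithIrrationalPoints q 3 (twist t t≉0 E)
  twisted-subgroup E point = record
    { G                = Triple X Y
    ; isSubgroup       = triple-isSubgroup flexᴷ
    ; order            = triple-cardinality (IsFlex.y≉0 flexᴷ)
    ; frobenius-stable = frobenius-stable
    ; irrational       = irrational
    }
    where
    open OnEquation (baseChange (EllipticCurve.eqn (twist t t≉0 E)))
    open GroupLaw K (baseChange (EllipticCurve.eqn (twist t t≉0 E)))
    E-flex = rational-point⇒flex E point
    x = proj₁ E-flex
    y = proj₁ (proj₂ E-flex)
    f = proj₂ (proj₂ E-flex)
    X = s ^ 2 * ι x
    Y = s ^ 3 * ι y
    flexᴷ : IsFlex (ι (t F.^ 2 F.* EllipticCurve.A E)) (ι (t F.^ 3 F.* EllipticCurve.B E)) X Y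
    flexᴷ = flex-cong (s⁴≈ _) (s⁶≈ _) refl refl (flex-scale s≉0 (flex-ascend f))
    ±Y∉base : ∀ {y′} → y′ ≈ Y ⊎ y′ ≈ - Y → ¬ InBase y′
    ±Y∉base (inj₁ r) (w , e) = s³ιy∉base (F₃.IsFlex.y≉0 f) (w , trans e r)
    ±Y∉base (inj₂ r) (w , e) = s³ιy∉base (F₃.IsFlex.y≉0 f)
      (let (w′ , e′) = inBase-neg (w , e) in w′ , trans e′ (x≈-y⇒-x≈y r))
    X-fixed : X ^ q ≈ X
    X-fixed = trans (^-congˡ q (s²ι x)) (trans (ι-frobenius _) (sym (s²ι x)))
    Y² : ∀ {y′} → y′ ≈ Y ⊎ y′ ≈ - Y → y′ ^ 2 ≈ Y ^ 2
    Y² (inj₁ r) = ^-congˡ 2 r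
    Y² (inj₂ r) = trans (^-congˡ 2 r) (solveᵣ 1 (λ y → (:- y) :^ 2 := y :^ 2) refl Y)
    Y²∈base : InBase (Y ^ 2)
    Y²∈base = t F.^ 3 F.* y F.^ 2 , (begin
      ι (t F.^ 3 F.* y F.^ 2)   ≈⟨ sym (s⁶≈ _) ⟩
      s ^ 6 * ι (y F.^ 2)       ≈⟨ *-congˡ (ι-^ y 2) ⟩
      s ^ 6 * ι y ^ 2           ≈⟨ solveᵣ 2 (λ s y → s :^ 6 :* y :^ 2 := (s :^ 3 :* y) :^ 2) refl s (ι y) ⟩
      Y ^ 2                     ∎)
    frobenius-stable : ∀ {P} → Triple X Y P → Triple X Y (frobenius q P)
    frobenius-stable neutral                  = neutral
    frobenius-stable {aff _ y′} (±point p r) = ±point (trans (^-congˡ q p) X-fixed)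
      ([ inj₁ ∘ trans y′^q≈ , inj₂ ∘ trans y′^q≈ ]′ (sign-flip r))
      where
      y′^q≈ : y′ ^ q ≈ - y′
      y′^q≈ = frobenius-sqrt (proj₁ Y²∈base , trans (proj₂ Y²∈base) (sym (Y² r))) (±Y∉base r)
    irrational : ∀ {P} → Triple X Y P → ¬ P ≈ₚ 𝒪 → ¬ DefinedOverBase P
    irrational neutral      P≉𝒪 _                       = P≉𝒪 𝒪≈
    irrational (±point p r) _   (aff _ w , aff≈ _ e)    = ±Y∉base r (w , e)

  twisted-point : ∀ E → RationalSubgroupWithIrrationalPoints q 3 E →
                  HasRationalPointOfOrder 3 (twist t t≉0 E)
  twisted-point E R = go (order3⇒flexPoint isSubgroup nonsingularᴷ order)
    where
    open RationalSubgroupWithIrrationalPoints R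
    module E = EllipticCurve E
    open GroupLaw K (baseChange E.eqn) using (aff≈)
    open OnEquation (baseChange E.eqn)
    nonsingularᴷ : ¬ 4 · ι E.A ^ 3 + 27 · ι E.B ^ 2 ≈ 0#
    nonsingularᴷ e = ι-nonzero E.nonsingular (trans (ι-discriminant E.A E.B) e)
    go : FlexPoint isSubgroup → HasRationalPointOfOrder 3 (twist t t≉0 E)
    go (x , y , g , f , x-unique) = aff (t F.* x₀) (t F.* w) , F₃.IsFlex.onCurve twisted , F₃.OnEquation.flex⇒order3 (EllipticCurve.eqn (twist t t≉0 E)) twisted
      where
      x∈base : InBase x
      -- The Frobenius image of (x , y) is an affine member of `G`, so its abscissa x^q is x.
      x∈base = frobenius-fixed (x-unique (frobenius-stable g))
      x₀ = proj₁ x∈base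
      y∉base : ¬ InBase y
      -- With x already in the base, a preimage of y would make the whole point rational.
      y∉base (y₀ , e) = irrational g (λ ()) (aff x₀ y₀ , aff≈ (proj₂ x∈base) e)
      y²∈base : InBase (y ^ 2)
      y²∈base = x₀ F.^ 3 F.+ E.A F.* x₀ F.+ E.B , (begin
        ι (x₀ F.^ 3 F.+ E.A F.* x₀ F.+ E.B)     ≈⟨ ι-cubic E.A E.B x₀ ⟩
        ι x₀ ^ 3 + ι E.A * ι x₀ + ι E.B         ≈⟨ +-congʳ (+-cong (^-congˡ 3 (proj₂ x∈base)) (*-congˡ (proj₂ x∈base))) ⟩
        x ^ 3 + ι E.A * x + ι E.B               ≈⟨ sym (IsFlex.onCurve f) ⟩
        y ^ 2                                   ∎)
      sy∈base : InBase (s * y)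
      sy∈base = sqrt-product-inBase (t , sym s²≈ιt) s∉base y²∈base y∉base
      w = proj₁ sy∈base
      twisted : F₃.IsFlex (t F.^ 2 F.* E.A) (t F.^ 3 F.* E.B) (t F.* x₀) (t F.* w)
      twisted = flex-descend (flex-cong (s⁴≈ _) (s⁶≈ _)
        (trans (*-congˡ (sym (proj₂ x∈base))) (s²ι x₀))
        (begin
          s ^ 3 * y          ≈⟨ solveᵣ 2 (λ s y → s :^ 3 :* y := s :^ 2 :* (s :* y)) refl s y ⟩
          s ^ 2 * (s * y)    ≈⟨ *-congˡ (sym (proj₂ sy∈base)) ⟩
          s ^ 2 * ι w        ≈⟨ s²ι w ⟩
          ι (t F.* w)        ∎)
        (flex-scale s≉0 f))

mainTheorem2 : ∀ {c ℓ c′ ℓ′} (F : Field c ℓ) (F̄ : AlgebraicClosure F c′ ℓ′) (q : ℕ) →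
    HasCardinality (Field.setoid F) q →
    ¬ Field._≈_ F (Field._·_ F 2 (Field.1# F)) (Field.0# F) →
    q % 3 ≡ 1 →
    (t : Field.Carrier F) (t≉0 : ¬ Field._≈_ F t (Field.0# F)) →
    ¬ Field.IsSquare F t →
    Σ[ f ∈ Bijection (Curves.curvesWithRationalPointOfOrder F 3)
    (Geometric.curvesWithRationalSubgroupWithIrrationalPoints F F̄ q 3) ]
    (∀ E → _≅_ F (proj₁ (Bijection.to f E)) (Curves.twist F t t≉0 (proj₁ E)))
mainTheorem2 F F̄ q card 2≉0 q%3≡1 t t≉0 nonsquare = record
  { to        = λ (E , point) → twist t t≉0 E , twisted-subgroup E point
  -- Equality in both setoids is isomorphism of the underlying curves, so congruence and injectivity
  -- are statements about `twist` alone.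
  ; cong      = twist-cong t t≉0
  ; bijective = twist-injective t t≉0
              -- The preimage of a curve is its own twist; anything isomorphic to it is twisted
              -- along and brought back by `twist-involutive`.
              , λ (E , subgroup) → (twist t t≉0 E , twisted-point E subgroup) ,
                  λ z≅ → ≅-trans (twist-cong t t≉0 z≅) (twist-involutive t t≉0 E)
  } , λ _ → ≅-refl
  where
  open Curves F
  open Scaling F 2≉0 (FiniteField.q%n≡1⇒n·1≉0 F q card 3 q%3≡1)
  open Twisting F F̄ q card 2≉0 t t≉0 nonsquare
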